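{- For every fixed $a\in(0,1/2]$, \[ \lim_{n\to\infty}\overline{\Lambda}(n;a)=\theta(a):=\begin{cases}\frac{(1-\sqrt a)^{2}}{a}, & 0<a<\frac14,\\[2pt] \frac{1}{2a}-1, & \frac14\le a\le\frac12.\end{cases} \]
   Context: For integers $n\ge1$, $k\in[0:n]$ and real $x$, the Krawtchouk polynomial is $K_k(x)=K_k^{(n)}(x):=\sum_{j=0}^{k}(-1)^{j}\binom{x}{j}\binom{n-x}{k-j}$, with generalized binomial coefficients $\binom{x}{j}=\frac{x(x-1)\cdots(x-j+1)}{j!}$. Here $[m:n]=\{m,m+1,\dots,n\}$. For real $a\in(0,1/2]$, $\overline{\Lambda}(n;a)$ is the optimal value of the linear program: maximize $-\sum_{k=1}^{n}\left[K_k(0)+K_k(1)\left(\frac1a-1\right)\right]x_k$ over $(x_1,\dots,x_n)\in\mathbb{R}^n$ subject to $x_k\ge0$ for $k\in[1:n]$ and $\sum_{k=1}^{n}[K_k(1)-K_k(i)]x_k\ge -1$ for all $i\in[2:n]$. -}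

module Defs where

open import Algebra.Bundles using (CommutativeRing; CommutativeSemiring)
open import Algebra.Core using (Op₁; Op₂)
open import Algebra.Structures using (IsCommutativeRing)
open import Data.Bool.Base using (if_then_else_)
open import Data.Empty using (⊥)
open import Data.Fin.Base using (toℕ)
open import Data.Nat.Base as ℕ using (ℕ; zero; suc; _∸_; _!)
open import Data.Product.Base using (∃-syntax; _×_; _,_; proj₁; proj₂)
open import Data.Sum.Base using (inj₁; inj₂)
open import Data.Vec.Functional using (Vector)
open import Level using (_⊔_; Lift; lift; lower) renaming (suc to lsuc)
open import Relation.Binary.Bundles using (DecTotalOrder)
open import Relation.Binary.Core using (Rel)
open import Relation.Binary.Definitions using (Decidable)
open import Relation.Binary.Structures using (IsDecTotalOrder)
open import Relation.Nullary.Decidable.Core using (does; yes; no)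
open import Relation.Nullary.Negation.Core using (¬_; contradiction)
import Algebra.Solver.Ring.NaturalCoefficients.Default as SemiringSolver
import Algebra.Properties.Semiring.Exp as Exp
import Algebra.Properties.Semiring.Mult as Mult
import Algebra.Properties.Semiring.Sum as Sum
import Relation.Binary.Construct.NonStrictToStrict as ToStrict
import Relation.Binary.Reasoning.Setoid as SetoidReasoning
import Relation.Binary.Properties.DecTotalOrder as DecTotalOrderProperties

-- The classical real numbers, given axiomatically as a Dedekind-complete
-- ordered field; classically this determines them up to isomorphism.
--
-- The order is decidable, and a supremum is an upper bound that can be
-- approximated from within the set.  Given a decidable order, "least upper
-- bound" would only yield approximants up to double negation; classically
-- the two notions agree.

record CompleteOrderedField c ℓ₁ ℓ₂ : Set (lsuc (c ⊔ ℓ₁ ⊔ ℓ₂)) where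
  infix  8 -_ _⁻¹
  infixl 7 _*_
  infixl 6 _+_
  infix  4 _≈_ _≤_
  field
    Carrier : Set c
    _≈_     : Rel Carrier ℓ₁
    _≤_     : Rel Carrier ℓ₂
    _+_ _*_ : Op₂ Carrier
    -_ _⁻¹  : Op₁ Carrier
    0# 1#   : Carrier
    isCommutativeRing : IsCommutativeRing _≈_ _+_ _*_ -_ 0# 1#
    isDecTotalOrder   : IsDecTotalOrder _≈_ _≤_

  open ToStrict _≈_ _≤_ public using (_<_)

  UpperBound : (Carrier → Set (c ⊔ ℓ₁ ⊔ ℓ₂)) → Carrier → Set (c ⊔ ℓ₁ ⊔ ℓ₂)
  UpperBound P b = ∀ {x} → P x → x ≤ b

  IsSup : (Carrier → Set (c ⊔ ℓ₁ ⊔ ℓ₂)) → Carrier → Set (c ⊔ ℓ₁ ⊔ ℓ₂)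
  IsSup P s = UpperBound P s × (∀ {y} → y < s → ∃[ x ] P x × y < x)

  field
    0≉1        : ¬ (0# ≈ 1#)
    ⁻¹-cong    : ∀ {x y} → x ≈ y → x ⁻¹ ≈ y ⁻¹
    -- The value of 0# ⁻¹ is unspecified.
    ⁻¹-inverse : ∀ {x} → ¬ (x ≈ 0#) → x * x ⁻¹ ≈ 1#
    +-monoʳ-≤  : ∀ x {y z} → y ≤ z → x + y ≤ x + z
    *-nonneg   : ∀ {x y} → 0# ≤ x → 0# ≤ y → 0# ≤ x * y
    complete   : ∀ (P : Carrier → Set (c ⊔ ℓ₁ ⊔ ℓ₂)) →
                 ∃[ x ] P x → ∃[ b ] UpperBound P b → ∃[ s ] IsSup P s

  commutativeRing : CommutativeRing c ℓ₁
  commutativeRing = record { isCommutativeRing = isCommutativeRing }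

  open CommutativeRing commutativeRing public
    hiding (Carrier; _≈_; _+_; _*_; -_; 0#; 1#; isCommutativeRing)
  open Mult semiring public using () renaming (_×_ to _·_)
  open Exp semiring public using (_^_)
  open Sum semiring public using (sum; sum-syntax; sum⁺-syntax)

  decTotalOrder : DecTotalOrder c ℓ₁ ℓ₂
  decTotalOrder = record { isDecTotalOrder = isDecTotalOrder }

  open IsDecTotalOrder isDecTotalOrder public
    using (_≟_; _≤?_; total; antisym)
    renaming (refl to ≤-refl; trans to ≤-trans; reflexive to ≤-reflexive)

  infix 4 _<?_
  _<?_ : Decidable _<_
  _<?_ = ToStrict.<-decidable _≈_ _≤_ _≟_ _≤?_

  infixl 7 _/_
  _/_ : Op₂ Carrier
  x / y = x * y ⁻¹

  fromℕ : ℕ → Carrier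
  fromℕ n = n · 1#

  ∣_∣ : Op₁ Carrier
  ∣ x ∣ = if does (0# ≤? x) then x else - x

-- Solving these over an abstract semiring keeps the solver from unfolding
-- the semiring derived from a CompleteOrderedField.
private module SemiringIdentities {c ℓ} (S : CommutativeSemiring c ℓ) where
  open CommutativeSemiring S
  open SemiringSolver S using (solve; _:=_; _:+_; _:*_; con)

  identity1 : ∀ x d → (x + d) * x ≈ x * d + x * x
  identity1 = solve 2 (λ x d → (x :+ d) :* x := x :* d :+ x :* x) refl

  identity2 : ∀ x i y → (x * i) * y ≈ i * (x * y)
  identity2 = solve 3 (λ x i y → (x :* i) :* y := i :* (x :* y)) refl

  identity3 : ∀ a r → (a + 1# + r) * (a + 1# + r) ≈ a + (1# + (a * a + a + (a + a + r + 1# + 1#) * r))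
  identity3 = solve 2 (λ a r → (a :+ con 1 :+ r) :* (a :+ con 1 :+ r) := a :+ (con 1 :+ (a :* a :+ a :+ (a :+ a :+ r :+ con 1 :+ con 1) :* r))) refl

  identity4 : ∀ s d h → (1# + (s + s)) * h + d * h ≈ (1# + (s + s + d)) * h
  identity4 = solve 3 (λ s d h → (con 1 :+ (s :+ s)) :* h :+ d :* h := (con 1 :+ (s :+ s :+ d)) :* h) refl

  identity5 : ∀ m h d → (m * h) * d ≈ m * (d * h)
  identity5 = solve 3 (λ m h d → (m :* h) :* d := m :* (d :* h)) refl

  identity6 : ∀ s e k d → (s + e) * (s + e) + (k + d) * e ≈ s * s + ((k + e) + (s + s + d)) * e
  identity6 = solve 4 (λ s e k d → (s :+ e) :* (s :+ e) :+ (k :+ d) :* e := s :* s :+ ((k :+ e) :+ (s :+ s :+ d)) :* e) refl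

  identity7 : ∀ e m h → e * (m * h) ≈ m * (e * h)
  identity7 = solve 3 (λ e m h → e :* (m :* h) := m :* (e :* h)) refl

  identity8 : ∀ s a e h → (s * s + a) * h + e * h ≈ (s * s + (a + e)) * h
  identity8 = solve 4 (λ s a e h → (s :* s :+ a) :* h :+ e :* h := (s :* s :+ (a :+ e)) :* h) refl

  identity9 : ∀ s h → (s * s + s * s) * h ≈ s * ((s + s) * h)
  identity9 = solve 2 (λ s h → (s :* s :+ s :* s) :* h := s :* ((s :+ s) :* h)) refl

  identity10 : ∀ p y a → (p * (y + y) + p * p) + (a + p * p) ≈ a + ((y + p) + (y + p)) * p
  identity10 = solve 3 (λ p y a → (p :* (y :+ y) :+ p :* p) :+ (a :+ p :* p) := a :+ ((y :+ p) :+ (y :+ p)) :* p) refl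

  identity11 : ∀ p y → (y + p) * (y + p) ≈ (p * (y + y) + p * p) + y * y
  identity11 = solve 2 (λ p y → (y :+ p) :* (y :+ p) := (p :* (y :+ y) :+ p :* p) :+ y :* y) refl

  identity12 : ∀ y r → (y + r) * (y + r) ≈ y * y + (y + y + r) * r
  identity12 = solve 2 (λ y r → (y :+ r) :* (y :+ r) := y :* y :+ (y :+ y :+ r) :* r) refl

module _ {c ℓ₁ ℓ₂} (R : CompleteOrderedField c ℓ₁ ℓ₂) where
  open CompleteOrderedField R
  open DecTotalOrderProperties decTotalOrder using (≰⇒>; <⇒≱)

  IsSup⇒least : ∀ {P s} → IsSup P s → ∀ {b} → UpperBound P b → s ≤ b
  IsSup⇒least {P} {s} (_ , approx) {b} ub with s ≤? b
  ... | yes s≤b = s≤b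
  ... | no  s≰b with approx (≰⇒> s≰b)
  ...   | x , Px , b<x = contradiction (ub Px) (<⇒≱ b<x)

  IsSup-unique : ∀ {P s t} → IsSup P s → IsSup P t → s ≈ t
  IsSup-unique sup-s sup-t =
    antisym (IsSup⇒least sup-s (proj₁ sup-t)) (IsSup⇒least sup-t (proj₁ sup-s))

  private
    open SemiringIdentities commutativeSemiring
    open SetoidReasoning setoid

    ≤-resp : ∀ {x x′ y y′} → x ≈ x′ → y ≈ y′ → x ≤ y → x′ ≤ y′
    ≤-resp p q x≤y = ≤-trans (≤-reflexive (sym p)) (≤-trans x≤y (≤-reflexive q))

    cancel-+ : ∀ x y → - x + (x + y) ≈ y
    cancel-+ x y = begin
      - x + (x + y) ≈⟨ +-assoc _ _ _ ⟨
      (- x + x) + y ≈⟨ +-congʳ (-‿inverseˡ x) ⟩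
      0# + y        ≈⟨ +-identityˡ y ⟩
      y             ∎

    +-cancelˡ-≤ : ∀ x {y z} → x + y ≤ x + z → y ≤ z
    +-cancelˡ-≤ x x+y≤x+z = ≤-resp (cancel-+ x _) (cancel-+ x _) (+-monoʳ-≤ (- x) x+y≤x+z)

    +-cancelˡ : ∀ x {y z} → x + y ≈ x + z → y ≈ z
    +-cancelˡ x x+y≈x+z = trans (sym (cancel-+ x _)) (trans (+-congˡ x+y≈x+z) (cancel-+ x _))

    x≤x+y : ∀ x {y} → 0# ≤ y → x ≤ x + y
    x≤x+y x 0≤y = ≤-resp (+-identityʳ x) refl (+-monoʳ-≤ x 0≤y)

    +-nonneg : ∀ {x y} → 0# ≤ x → 0# ≤ y → 0# ≤ x + y
    +-nonneg 0≤x 0≤y = ≤-trans 0≤x (x≤x+y _ 0≤y)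

    difference : ∀ {x y} → x ≤ y → ∃[ d ] 0# ≤ d × x + d ≈ y
    difference {x} {y} x≤y =
      - x + y , ≤-resp (-‿inverseˡ x) refl (+-monoʳ-≤ (- x) x≤y) , (begin
      x + (- x + y) ≈⟨ +-assoc _ _ _ ⟨
      (x - x) + y   ≈⟨ +-congʳ (-‿inverseʳ x) ⟩
      0# + y        ≈⟨ +-identityˡ y ⟩
      y             ∎)

    positive-difference : ∀ {x y} → x < y → ∃[ d ] 0# < d × x + d ≈ y
    positive-difference {x} (x≤y , x≉y) with difference x≤y
    ... | d , 0≤d , x+d≈y = d , (0≤d , λ 0≈d → x≉y (trans (sym (+-identityʳ x)) (trans (+-congˡ 0≈d) x+d≈y))) , x+d≈y

    square-nonneg : ∀ x → 0# ≤ x * x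
    square-nonneg x with total 0# x
    ... | inj₁ 0≤x = *-nonneg 0≤x 0≤x
    ... | inj₂ x≤0 with difference x≤0
    ...   | d , 0≤d , x+d≈0 = ≤-resp refl (+-cancelˡ (x * d) d²≈x²) (*-nonneg 0≤d 0≤d)
      where
      d²≈x² : x * d + d * d ≈ x * d + x * x
      d²≈x² = begin
        x * d + d * d ≈⟨ distribʳ d x d ⟨
        (x + d) * d   ≈⟨ *-congʳ x+d≈0 ⟩
        0# * d        ≈⟨ zeroˡ d ⟩
        0#            ≈⟨ zeroˡ x ⟨
        0# * x        ≈⟨ *-congʳ x+d≈0 ⟨
        (x + d) * x   ≈⟨ identity1 x d ⟩
        x * d + x * x ∎

    0≤1 : 0# ≤ 1#
    0≤1 = ≤-resp refl (*-identityˡ 1#) (square-nonneg 1#)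

    ≉0-* : ∀ {x y} → ¬ (x ≈ 0#) → x * y ≈ 0# → y ≈ 0#
    ≉0-* {x} {y} x≉0 xy≈0 = begin
      y              ≈⟨ *-identityˡ y ⟨
      1# * y         ≈⟨ *-congʳ (⁻¹-inverse x≉0) ⟨
      (x * x ⁻¹) * y ≈⟨ identity2 x (x ⁻¹) y ⟩
      x ⁻¹ * (x * y) ≈⟨ *-congˡ xy≈0 ⟩
      x ⁻¹ * 0#      ≈⟨ zeroʳ _ ⟩
      0#             ∎

    -- For x > 0 the inverse is x · x⁻¹ · x⁻¹, hence nonnegative.
    reciprocal : ∀ {x} → 0# < x → ∃[ h ] 0# ≤ h × x * h ≈ 1#
    reciprocal {x} (0≤x , 0≉x) = x ⁻¹ , ≤-resp refl eq (*-nonneg 0≤x (square-nonneg (x ⁻¹))) , xh≈1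
      where
      xh≈1 : x * x ⁻¹ ≈ 1#
      xh≈1 = ⁻¹-inverse (λ x≈0 → 0≉x (sym x≈0))
      eq : x * (x ⁻¹ * x ⁻¹) ≈ x ⁻¹
      eq = trans (sym (*-assoc _ _ _)) (trans (*-congʳ xh≈1) (*-identityˡ _))

    <-+ : ∀ {x y} → 0# < x → 0# ≤ y → 0# < x + y
    <-+ {x} {y} (0≤x , 0≉x) 0≤y = +-nonneg 0≤x 0≤y , λ 0≈x+y →
      0≉x (antisym 0≤x (≤-resp refl (sym 0≈x+y) (x≤x+y x 0≤y)))

    module _ (a : Carrier) (0≤a : 0# ≤ a) where

      Below : Carrier → Set (c ⊔ ℓ₁ ⊔ ℓ₂)
      Below x = Lift (c ⊔ ℓ₁ ⊔ ℓ₂) (x * x ≤ a)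

      below-0 : Below 0#
      below-0 = lift (≤-resp (sym (zeroˡ 0#)) refl 0≤a)

      bound : UpperBound Below (a + 1#)
      bound {x} (lift x²≤a) with total x (a + 1#)
      ... | inj₁ x≤a+1 = x≤a+1
      ... | inj₂ a+1≤x with difference a+1≤x
      ...   | r , 0≤r , a+1+r≈x = contradiction (antisym 0≤1 1≤0) 0≉1
        where
        rest = a * a + a + (a + a + r + 1# + 1#) * r
        0≤rest : 0# ≤ rest
        0≤rest = +-nonneg (+-nonneg (*-nonneg 0≤a 0≤a) 0≤a)
          (*-nonneg (+-nonneg (+-nonneg (+-nonneg (+-nonneg 0≤a 0≤a) 0≤r) 0≤1) 0≤1) 0≤r)
        x²≈ : x * x ≈ a + (1# + rest)
        x²≈ = begin
          x * x                           ≈⟨ *-cong a+1+r≈x a+1+r≈x ⟨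
          (a + 1# + r) * (a + 1# + r)     ≈⟨ identity3 a r ⟩
          a + (1# + rest)                 ∎
        1≤0 : 1# ≤ 0#
        1≤0 = ≤-trans (x≤x+y 1# 0≤rest)
          (+-cancelˡ-≤ a (≤-resp x²≈ (sym (+-identityʳ a)) x²≤a))

      sup : ∃[ s ] IsSup Below s
      sup = complete Below (0# , below-0) (a + 1# , bound)

      module _ {s : Carrier} (isSup : IsSup Below s) where

        0≤s : 0# ≤ s
        0≤s = proj₁ isSup below-0

        s²+d≉a : ∀ d h → 0# < d → s * s + d ≈ a →
                 0# ≤ h → (1# + (s + s + d)) * h ≈ 1# → ⊥
        s²+d≉a d h (0≤d , 0≉d) s²+d≈a 0≤h mh≈1 = 0≉d (antisym 0≤d d≤0)
          where
          m = 1# + (s + s + d)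
          δ = d * h
          k = (1# + (s + s)) * h
          0≤δ : 0# ≤ δ
          0≤δ = *-nonneg 0≤d 0≤h
          k+δ≈1 : k + δ ≈ 1#
          k+δ≈1 = trans
            (identity4 s d h)
            mh≈1
          d≈mδ : d ≈ m * δ
          d≈mδ = begin
            d           ≈⟨ *-identityˡ d ⟨
            1# * d      ≈⟨ *-congʳ mh≈1 ⟨
            (m * h) * d ≈⟨ identity5 m h d ⟩
            m * δ       ∎
          expand : (s + δ) * (s + δ) + (k + d) * δ ≈ a
          expand = begin
            (s + δ) * (s + δ) + (k + d) * δ
              ≈⟨ identity6 s δ k d ⟩
            s * s + ((k + δ) + (s + s + d)) * δ
              ≈⟨ +-congˡ (*-congʳ (+-congʳ k+δ≈1)) ⟩
            s * s + m * δ
              ≈⟨ +-congˡ d≈mδ ⟨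
            s * s + d
              ≈⟨ s²+d≈a ⟩
            a ∎
          0≤k : 0# ≤ k
          0≤k = *-nonneg (+-nonneg 0≤1 (+-nonneg 0≤s 0≤s)) 0≤h
          s+δ-below : Below (s + δ)
          s+δ-below = lift (≤-resp refl expand (x≤x+y _ (*-nonneg (+-nonneg 0≤k 0≤d) 0≤δ)))
          δ≈0 : δ ≈ 0#
          δ≈0 = antisym (+-cancelˡ-≤ s (≤-resp refl (sym (+-identityʳ s)) (proj₁ isSup s+δ-below))) 0≤δ
          d≤0 : d ≤ 0#
          d≤0 = ≤-reflexive (trans d≈mδ (trans (*-congˡ δ≈0) (zeroʳ m)))

        ¬s²<a : ¬ (s * s < a)
        ¬s²<a s²<a =
          let d , 0<d , s²+d≈a = positive-difference s²<a
              h , 0≤h , mh≈1   = reciprocal (<-+ (0≤1 , 0≉1) (+-nonneg (+-nonneg 0≤s 0≤s) (proj₁ 0<d)))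
          in s²+d≉a d h 0<d s²+d≈a 0≤h mh≈1

        s²≉a+e : ∀ e h → 0# < e → a + e ≈ s * s → 0# ≤ h → (s + s) * h ≈ 1# → ⊥
        s²≉a+e e h (0≤e , 0≉e) a+e≈s² 0≤h 2sh≈1 =
          let z , z²≤a , y≤z , _ = proj₂ isSup y<s
              r , 0≤r , y+r≈z    = difference y≤z
          in impossible z r (lower z²≤a) 0≤r y+r≈z
          where
          p = e * h
          y = (s * s + a) * h
          0≤p : 0# ≤ p
          0≤p = *-nonneg 0≤e 0≤h
          0≤y : 0# ≤ y
          0≤y = *-nonneg (+-nonneg (square-nonneg s) 0≤a) 0≤h
          e≈2sp : e ≈ (s + s) * p
          e≈2sp = begin
            e                 ≈⟨ *-identityʳ e ⟨
            e * 1#            ≈⟨ *-congˡ 2sh≈1 ⟨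
            e * ((s + s) * h) ≈⟨ identity7 e (s + s) h ⟩
            (s + s) * p       ∎
          p≉0 : ¬ (p ≈ 0#)
          p≉0 p≈0 = 0≉e (sym (trans e≈2sp (trans (*-congˡ p≈0) (zeroʳ _))))
          y+p≈s : y + p ≈ s
          y+p≈s = begin
            (s * s + a) * h + e * h ≈⟨ identity8 s a e h ⟩
            (s * s + (a + e)) * h   ≈⟨ *-congʳ (+-congˡ a+e≈s²) ⟩
            (s * s + s * s) * h     ≈⟨ identity9 s h ⟩
            s * ((s + s) * h)       ≈⟨ *-congˡ 2sh≈1 ⟩
            s * 1#                  ≈⟨ *-identityʳ s ⟩
            s                       ∎
          y<s : y < s
          y<s = ≤-resp refl y+p≈s (x≤x+y y 0≤p) , λ y≈s →
            p≉0 (+-cancelˡ y (trans y+p≈s (trans (sym y≈s) (sym (+-identityʳ y)))))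
          y²≈a+p² : y * y ≈ a + p * p
          y²≈a+p² = sym (+-cancelˡ (p * (y + y) + p * p) (begin
            (p * (y + y) + p * p) + (a + p * p)
              ≈⟨ identity10 p y a ⟩
            a + ((y + p) + (y + p)) * p
              ≈⟨ +-congˡ (*-congʳ (+-cong y+p≈s y+p≈s)) ⟩
            a + (s + s) * p
              ≈⟨ +-congˡ e≈2sp ⟨
            a + e
              ≈⟨ a+e≈s² ⟩
            s * s
              ≈⟨ *-cong y+p≈s y+p≈s ⟨
            (y + p) * (y + p)
              ≈⟨ identity11 p y ⟩
            (p * (y + y) + p * p) + y * y ∎))
          impossible : ∀ z r → z * z ≤ a → 0# ≤ r → y + r ≈ z → ⊥
          impossible z r z²≤a 0≤r y+r≈z = p≉0 (≉0-* p≉0 (antisym p²≤0 (square-nonneg p)))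
            where
            rest = (y + y + r) * r
            0≤rest : 0# ≤ rest
            0≤rest = *-nonneg (+-nonneg (+-nonneg 0≤y 0≤y) 0≤r) 0≤r
            z²≈ : z * z ≈ a + (p * p + rest)
            z²≈ = begin
              z * z               ≈⟨ *-cong y+r≈z y+r≈z ⟨
              (y + r) * (y + r)   ≈⟨ identity12 y r ⟩
              y * y + rest        ≈⟨ +-congʳ y²≈a+p² ⟩
              (a + p * p) + rest  ≈⟨ +-assoc _ _ _ ⟩
              a + (p * p + rest)  ∎
            p²≤0 : p * p ≤ 0#
            p²≤0 = ≤-trans (x≤x+y _ 0≤rest)
              (+-cancelˡ-≤ a (≤-resp z²≈ (sym (+-identityʳ a)) z²≤a))

        ¬a<s² : ¬ (a < s * s)
        ¬a<s² a<s² =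
          let e , 0<e , a+e≈s² = positive-difference a<s²
              h , 0≤h , 2sh≈1  = reciprocal (<-+ (0≤s , 0≉s) 0≤s)
          in s²≉a+e e h 0<e a+e≈s² 0≤h 2sh≈1
          where
          0≉s : ¬ (0# ≈ s)
          0≉s 0≈s = <⇒≱ a<s² (≤-resp (trans (sym (zeroˡ s)) (*-congʳ 0≈s)) refl 0≤a)

        s²≈a : s * s ≈ a
        s²≈a = antisym s²≤a a≤s²
          where
          s²≤a : s * s ≤ a
          s²≤a with s * s ≤? a
          ... | yes le = le
          ... | no  nle = contradiction (≰⇒> nle) ¬a<s²
          a≤s² : a ≤ s * s
          a≤s² with a ≤? s * s
          ... | yes le = le
          ... | no  nle = contradiction (≰⇒> nle) ¬s²<a

  sqrt : ∀ a → 0# ≤ a → ∃[ s ] 0# ≤ s × s * s ≈ a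
  sqrt a 0≤a =
    let s , isSup = sup a 0≤a
    in s , 0≤s a 0≤a isSup , s²≈a a 0≤a isSup

  √ : ∀ a → 0# ≤ a → Carrier
  √ a 0≤a = proj₁ (sqrt a 0≤a)

  -- A sequence whose n-th term is given as the relation "v is the n-th
  -- term", so that finitely many terms may fail to exist (be infinite).
  HasLimit : ∀ {ℓ} → (ℕ → Carrier → Set ℓ) → Carrier → Set (c ⊔ ℓ₁ ⊔ ℓ₂ ⊔ ℓ)
  HasLimit V L = ∀ ε → 0# < ε →
    ∃[ N ] ∀ n → N ℕ.≤ n → ∃[ v ] V n v × ∣ v - L ∣ < ε

  infixl 8 _↓_
  _↓_ : Carrier → ℕ → Carrier
  x ↓ zero  = 1#
  x ↓ suc j = x ↓ j * (x - fromℕ j)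

  binom : Carrier → ℕ → Carrier
  binom x j = x ↓ j / fromℕ (j !)

  K : ℕ → ℕ → Carrier → Carrier
  K n k x = ∑[ j ≤ k ] ((- 1#) ^ toℕ j * binom x (toℕ j) * binom (fromℕ n - x) (k ∸ toℕ j))

  -- x_k for k ∈ [1:n] is stored at the index j : Fin n with k = suc (toℕ j).
  objective : ∀ n → Carrier → Vector Carrier n → Carrier
  objective n a x =
    - (∑[ j < n ] ((K n (suc (toℕ j)) 0# + K n (suc (toℕ j)) 1# * (1# / a - 1#)) * x j))

  Feasible : ∀ n → Vector Carrier n → Set ℓ₂
  Feasible n x =
    (∀ j → 0# ≤ x j) ×
    (∀ i → 2 ℕ.≤ i → i ℕ.≤ n →
      - 1# ≤ ∑[ j < n ] ((K n (suc (toℕ j)) 1# - K n (suc (toℕ j)) (fromℕ i)) * x j))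

  -- For small n and a the program is unbounded and no v qualifies.
  IsOptimalValue : ℕ → Carrier → Carrier → Set (c ⊔ ℓ₁ ⊔ ℓ₂)
  IsOptimalValue n a v =
    IsSup (λ y → ∃[ x ] Feasible n x × y ≈ objective n a x) v

  θ : ∀ a → 0# < a → Carrier
  θ a (0≤a , _) =
    if does (a <? 1# / fromℕ 4)
    then (1# - √ a 0≤a) ^ 2 / a
    else 1# / (fromℕ 2 * a) - 1#

{-# OPTIONS --safe #-}

-- Write c = 1/a − 1. Since Σₖ Kₖ(i) pᵏ qⁿ⁻ᵏ = (q − p)ⁱ when p + q = 1, putting x_k = Y pᵏ qⁿ⁻ᵏ and
-- t = p − q ≥ 0 turns the constraints into Y (t + (−t)ⁱ) ≤ 1, the worst of which is i = 2, and gives an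
-- objective of at least (c t − 1) / (t + t²).  The maximum of this over t ∈ (0,1] is θ(a), attained at
-- t = √a / (1 − √a) if a < 1/4 and at t = 1 otherwise; so the optimum is at least θ(a) for every n ≥ 2.
-- Conversely, putting the multiplier w = θ(a) (if a ≥ 1/4) or w = θ(a) + ε (if a < 1/4, n large) on
-- the constraint i = 2 alone bounds the objective by w: in terms of C(n−2,k), C(n−2,k−1), C(n−2,k−2)
-- the dual inequality has nonnegative coefficients in the first case and is, up to a positive
-- factor, a positive definite quadratic form in (n − k, k) minus terms of order n in the second.
module Submission where

open import Defs
open import Algebra.Bundles using (CommutativeRing)
open import Algebra.Solver.Ring.AlmostCommutativeRing using (_-Raw-AlmostCommutative⟶_; fromCommutativeRing)
open import Data.Integer.Base as ℤ using (ℤ; +_; -[1+_]; _⊖_)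
open import Data.Maybe.Base using (Maybe; just; nothing)
open import Data.Bool.Base using (if_then_else_)
open import Data.Fin.Base as Fin using (Fin; toℕ)
open import Data.Nat.Base as ℕ using (ℕ; zero; suc; _∸_; _!; s≤s; z≤n)
open import Data.Product.Base using (∃-syntax; _×_; _,_; proj₁; proj₂)
open import Data.Sum.Base using (_⊎_; inj₁; inj₂)
open import Data.Vec.Functional using (Vector)
open import Level using (_⊔_; Lift; lift)
import Relation.Binary.PropositionalEquality.Core as ≡
open import Relation.Nullary.Decidable.Core using (Dec; does; yes; no)
open import Relation.Nullary.Negation.Core using (¬_; contradiction)
import Algebra.Properties.Ring as RingProperties
import Algebra.Properties.AbelianGroup as AbelianGroupProperties
import Algebra.Properties.Semiring.Mult as Mult
import Algebra.Properties.Semiring.Sum as Sum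
import Algebra.Properties.Semiring.Mult.TCOptimised as Mult′
import Algebra.Solver.Ring as RingSolver
import Data.Fin.Properties as Fin
import Data.Integer.Properties as ℤ
import Data.Nat.Properties as ℕ
import Relation.Binary.Properties.DecTotalOrder as DecTotalOrderProperties
import Relation.Binary.Reasoning.Setoid as SetoidReasoning

-- Ring solver with integer coefficients over a commutative ring

module IntegerCoefficients {c ℓ} (R : CommutativeRing c ℓ) where
  open CommutativeRing R
  -- With these multiples ⟦ + 1 ⟧ℤ is 1# definitionally, so that the solver's :1 stands for 1#.
  open Mult′ semiring renaming (_×_ to _·_)
  open RingProperties ring using (-‿distribˡ-*; -‿distribʳ-*; -‿involutive; -0#≈0#)
  open AbelianGroupProperties +-abelianGroup using (⁻¹-∙-comm)
  open SetoidReasoning setoid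

  ⟦_⟧ℤ : ℤ → Carrier
  ⟦ + n ⟧ℤ      = n · 1#
  ⟦ -[1+ n ] ⟧ℤ = - (suc n · 1#)

  cancel-1+ : ∀ x y → (1# + x) - (1# + y) ≈ x - y
  cancel-1+ x y = begin
    (1# + x) - (1# + y)     ≈⟨ +-congˡ (⁻¹-∙-comm 1# y) ⟨
    (1# + x) + (- 1# - y)   ≈⟨ +-congʳ (+-comm 1# x) ⟩
    (x + 1#) + (- 1# - y)   ≈⟨ +-assoc x 1# _ ⟩
    x + (1# + (- 1# - y))   ≈⟨ +-congˡ (+-assoc 1# (- 1#) (- y)) ⟨
    x + ((1# - 1#) - y)     ≈⟨ +-congˡ (+-congʳ (-‿inverseʳ 1#)) ⟩
    x + (0# - y)            ≈⟨ +-congˡ (+-identityˡ (- y)) ⟩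
    x - y                   ∎

  ⊖-homo : ∀ m n → ⟦ m ⊖ n ⟧ℤ ≈ m · 1# - n · 1#
  ⊖-homo zero zero = sym (-‿inverseʳ 0#)
  ⊖-homo zero (suc n) = sym (+-identityˡ _)
  ⊖-homo (suc m) zero = sym (trans (+-congˡ -0#≈0#) (+-identityʳ _))
  ⊖-homo (suc m) (suc n) = begin
    ⟦ suc m ⊖ suc n ⟧ℤ                ≡⟨ ≡.cong ⟦_⟧ℤ (ℤ.[1+m]⊖[1+n]≡m⊖n m n) ⟩
    ⟦ m ⊖ n ⟧ℤ                        ≈⟨ ⊖-homo m n ⟩
    m · 1# - n · 1#                   ≈⟨ cancel-1+ _ _ ⟨
    (1# + m · 1#) - (1# + n · 1#)     ≈⟨ +-cong (1+× m 1#) (-‿cong (1+× n 1#)) ⟨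
    suc m · 1# - suc n · 1#           ∎

  +-homo : ∀ i j → ⟦ i ℤ.+ j ⟧ℤ ≈ ⟦ i ⟧ℤ + ⟦ j ⟧ℤ
  +-homo (+ m) (+ n) = ×-homo-+ 1# m n
  +-homo (+ m) -[1+ n ] = ⊖-homo m (suc n)
  +-homo -[1+ m ] (+ n) = trans (⊖-homo n (suc m)) (+-comm _ _)
  +-homo -[1+ m ] -[1+ n ] = begin
    - (suc (suc (m ℕ.+ n)) · 1#)       ≡⟨ ≡.cong (λ k → - (k · 1#)) (≡.cong suc (ℕ.+-suc m n)) ⟨
    - ((suc m ℕ.+ suc n) · 1#)         ≈⟨ -‿cong (×-homo-+ 1# (suc m) (suc n)) ⟩
    - (suc m · 1# + suc n · 1#)        ≈⟨ ⁻¹-∙-comm _ _ ⟨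
    - (suc m · 1#) - suc n · 1#        ∎

  -‿homo : ∀ i → ⟦ ℤ.- i ⟧ℤ ≈ - ⟦ i ⟧ℤ
  -‿homo (+ zero)  = sym -0#≈0#
  -‿homo (+ suc n) = refl
  -‿homo -[1+ n ]  = sym (-‿involutive _)

  *-homo-+ : ∀ m j → ⟦ + m ℤ.* j ⟧ℤ ≈ m · 1# * ⟦ j ⟧ℤ
  *-homo-+ m (+ n) = trans (reflexive (≡.cong ⟦_⟧ℤ (≡.sym (ℤ.pos-* m n)))) (×1-homo-* m n)
  *-homo-+ m -[1+ n ] = begin
    ⟦ + m ℤ.* -[1+ n ] ⟧ℤ           ≡⟨ ≡.cong ⟦_⟧ℤ (ℤ.neg-distribʳ-* (+ m) (+ suc n)) ⟨
    ⟦ ℤ.- (+ m ℤ.* + suc n) ⟧ℤ      ≈⟨ -‿homo (+ m ℤ.* + suc n) ⟩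
    - ⟦ + m ℤ.* + suc n ⟧ℤ          ≈⟨ -‿cong (*-homo-+ m (+ suc n)) ⟩
    - (m · 1# * (suc n · 1#))       ≈⟨ -‿distribʳ-* _ _ ⟩
    m · 1# * - (suc n · 1#)         ∎

  *-homo : ∀ i j → ⟦ i ℤ.* j ⟧ℤ ≈ ⟦ i ⟧ℤ * ⟦ j ⟧ℤ
  *-homo (+ m) j = *-homo-+ m j
  *-homo -[1+ m ] j = begin
    ⟦ -[1+ m ] ℤ.* j ⟧ℤ             ≡⟨ ≡.cong ⟦_⟧ℤ (ℤ.neg-distribˡ-* (+ suc m) j) ⟨
    ⟦ ℤ.- (+ suc m ℤ.* j) ⟧ℤ        ≈⟨ -‿homo (+ suc m ℤ.* j) ⟩
    - ⟦ + suc m ℤ.* j ⟧ℤ            ≈⟨ -‿cong (*-homo-+ (suc m) j) ⟩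
    - (suc m · 1# * ⟦ j ⟧ℤ)         ≈⟨ -‿distribˡ-* _ _ ⟩
    - (suc m · 1#) * ⟦ j ⟧ℤ         ∎

  morphism : ℤ.+-*-rawRing -Raw-AlmostCommutative⟶ fromCommutativeRing R
  morphism = record
    { ⟦_⟧ = ⟦_⟧ℤ ; +-homo = +-homo ; *-homo = *-homo
    ; -‿homo = -‿homo ; 0-homo = refl ; 1-homo = refl }

  -- Distinct integers may still have equal images in the ring, so a failed comparison yields
  -- `nothing` rather than a refutation.
  _≟ℤ_ : ∀ i j → Maybe (⟦ i ⟧ℤ ≈ ⟦ j ⟧ℤ)
  i ≟ℤ j with i ℤ.≟ j
  ... | yes i≡j = just (reflexive (≡.cong ⟦_⟧ℤ i≡j))
  ... | no  _   = nothing

  open RingSolver ℤ.+-*-rawRing (fromCommutativeRing R) morphism _≟ℤ_ public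
    using (solve; _:=_; _:+_; _:*_; _:-_; :-_; con; Polynomial)

  :0 :1 : ∀ {n} → Polynomial n
  :0 = con (+ 0)
  :1 = con (+ 1)


-- Ordered field arithmetic, the Archimedean property and finite sums

module OrderedField {c ℓ₁ ℓ₂} (R : CompleteOrderedField c ℓ₁ ℓ₂) where
  open CompleteOrderedField R public hiding (zero)
  open IntegerCoefficients commutativeRing public
    using (solve; _:=_; _:+_; _:*_; _:-_; :-_; :0; :1)
  open DecTotalOrderProperties decTotalOrder public using (≰⇒>; <⇒≱)
  open Mult semiring public using (×-homo-+; ×1-homo-*)

  -- Proof by a cofactor: `m` exhibits x - y as a multiple of A - B, a polynomial identity left to
  -- the ring solver. Relations such as y y⁻¹ = 1, unknown to the solver, enter this way.
  ≈-by : ∀ {x y A B} m → A ≈ B → x ≈ y + m * (A - B) → x ≈ y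
  ≈-by {x} {y} {A} {B} m A≈B eq = trans eq (trans
    (+-congˡ (*-congˡ (+-congʳ A≈B)))
    (solve 3 (λ y m B → y :+ m :* (B :- B) := y) refl y m B))

  ≈-by₂ : ∀ {x y A B A′ B′} m m′ → A ≈ B → A′ ≈ B′ →
          x ≈ y + (m * (A - B) + m′ * (A′ - B′)) → x ≈ y
  ≈-by₂ m m′ A≈B A′≈B′ eq = ≈-by m A≈B (≈-by m′ A′≈B′ (trans eq (sym (+-assoc _ _ _))))

  ≤-resp : ∀ {x x′ y y′} → x ≈ x′ → y ≈ y′ → x ≤ y → x′ ≤ y′
  ≤-resp p q x≤y = ≤-trans (≤-reflexive (sym p)) (≤-trans x≤y (≤-reflexive q))

  0≤-resp : ∀ {x y} → x ≈ y → 0# ≤ x → 0# ≤ y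
  0≤-resp = ≤-resp refl

  -- Inequalities are handled as nonnegativity of a difference, so that a certificate is a sum of
  -- products of nonnegative terms that the solver can match.
  ≤⇒0≤- : ∀ {x y} → x ≤ y → 0# ≤ y - x
  ≤⇒0≤- {x} {y} x≤y = ≤-resp (-‿inverseˡ x) (+-comm (- x) y) (+-monoʳ-≤ (- x) x≤y)

  0≤-⇒≤ : ∀ {x y} → 0# ≤ y - x → x ≤ y
  0≤-⇒≤ {x} {y} 0≤y-x = ≤-resp (+-identityʳ x)
    (solve 2 (λ x y → x :+ (y :- x) := y) refl x y) (+-monoʳ-≤ x 0≤y-x)

  +-nonneg : ∀ {x y} → 0# ≤ x → 0# ≤ y → 0# ≤ x + y
  +-nonneg {x} 0≤x 0≤y = ≤-trans 0≤x (≤-resp (+-identityʳ x) refl (+-monoʳ-≤ x 0≤y))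

  square-nonneg : ∀ x → 0# ≤ x * x
  square-nonneg x with total 0# x
  ... | inj₁ 0≤x = *-nonneg 0≤x 0≤x
  ... | inj₂ x≤0 = 0≤-resp
    (solve 1 (λ x → (:0 :- x) :* (:0 :- x) := x :* x) refl x)
    (*-nonneg (≤⇒0≤- x≤0) (≤⇒0≤- x≤0))

  0≤1 : 0# ≤ 1#
  0≤1 = 0≤-resp (*-identityˡ 1#) (square-nonneg 1#)

  0<1 : 0# < 1#
  0<1 = 0≤1 , 0≉1

  +-pos : ∀ {x y} → 0# < x → 0# ≤ y → 0# < x + y
  +-pos {x} {y} (0≤x , 0≉x) 0≤y = +-nonneg 0≤x 0≤y , λ 0≈x+y →
    0≉x (antisym 0≤x (≤-resp (+-identityʳ x) (sym 0≈x+y) (+-monoʳ-≤ x 0≤y)))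

  <-≤-trans : ∀ {x y z} → x < y → y ≤ z → x < z
  <-≤-trans (x≤y , x≉y) y≤z = ≤-trans x≤y y≤z , λ x≈z →
    x≉y (antisym x≤y (≤-trans y≤z (≤-reflexive (sym x≈z))))

  ≤-<-trans : ∀ {x y z} → x ≤ y → y < z → x < z
  ≤-<-trans x≤y (y≤z , y≉z) = ≤-trans x≤y y≤z , λ x≈z →
    y≉z (antisym y≤z (≤-trans (≤-reflexive (sym x≈z)) x≤y))

  inverseʳ : ∀ {x} → 0# < x → x * x ⁻¹ ≈ 1#
  inverseʳ (_ , 0≉x) = ⁻¹-inverse (λ x≈0 → 0≉x (sym x≈0))

  -- For x > 0 the inverse is x · x⁻¹ · x⁻¹, hence nonnegative.
  ⁻¹-nonneg : ∀ {x} → 0# < x → 0# ≤ x ⁻¹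
  ⁻¹-nonneg {x} 0<x = 0≤-resp
    (≈-by (x ⁻¹) (inverseʳ 0<x)
      (solve 2 (λ x y → x :* (y :* y) := y :+ y :* (x :* y :- :1)) refl x (x ⁻¹)))
    (*-nonneg (proj₁ 0<x) (square-nonneg (x ⁻¹)))

  *-cancel-nonneg : ∀ {x y} → 0# < x → 0# ≤ x * y → 0# ≤ y
  *-cancel-nonneg {x} {y} 0<x 0≤xy = 0≤-resp
    (≈-by y (inverseʳ 0<x)
      (solve 3 (λ x y z → z :* (x :* y) := y :+ y :* (x :* z :- :1)) refl x y (x ⁻¹)))
    (*-nonneg (⁻¹-nonneg 0<x) 0≤xy)

  *-pos : ∀ {x y} → 0# < x → 0# < y → 0# < x * y
  *-pos {x} {y} 0<x (0≤y , 0≉y) = *-nonneg (proj₁ 0<x) 0≤y , λ 0≈xy → 0≉y (antisym 0≤y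
    (0≤-⇒≤ (*-cancel-nonneg 0<x (≤-reflexive (≈-by 1# (sym 0≈xy)
      (solve 2 (λ x y → :0 := x :* (:0 :- y) :+ :1 :* (x :* y :- :0)) refl x y))))))

  ≤-reciprocal : ∀ {x y} → 0# < y → x ≤ 1# / y → 0# ≤ 1# - y * x
  ≤-reciprocal {x} {y} 0<y x≤1/y = 0≤-resp
    (≈-by 1# (inverseʳ 0<y) (solve 3 (λ x y h → y :* (:1 :* h :- x)
      := (:1 :- y :* x) :+ :1 :* (y :* h :- :1)) refl x y (y ⁻¹)))
    (*-nonneg (proj₁ 0<y) (≤⇒0≤- x≤1/y))

  reciprocal-≤ : ∀ {x y} → 0# < y → 1# / y ≤ x → 0# ≤ y * x - 1#
  reciprocal-≤ {x} {y} 0<y 1/y≤x = 0≤-resp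
    (≈-by (- 1#) (inverseʳ 0<y) (solve 3 (λ x y h → y :* (x :- :1 :* h)
      := (y :* x :- :1) :+ (:- :1) :* (y :* h :- :1)) refl x y (y ⁻¹)))
    (*-nonneg (proj₁ 0<y) (≤⇒0≤- 1/y≤x))

  ^-nonneg : ∀ {x} → 0# ≤ x → ∀ n → 0# ≤ x ^ n
  ^-nonneg 0≤x zero    = 0≤1
  ^-nonneg 0≤x (suc n) = *-nonneg 0≤x (^-nonneg 0≤x n)

  fromℕ-nonneg : ∀ n → 0# ≤ fromℕ n
  fromℕ-nonneg zero    = ≤-refl
  fromℕ-nonneg (suc n) = +-nonneg 0≤1 (fromℕ-nonneg n)

  fromℕ-pos : ∀ n → 0# < fromℕ (suc n)
  fromℕ-pos n = +-pos 0<1 (fromℕ-nonneg n)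

  -- For x ≥ 0 let s be the supremum of the naturals not exceeding x, and n one of them with n > s -
  -- 1. Then n + 1 > s cannot lie below x.
  archimedean : ∀ x → ∃[ N ] x ≤ fromℕ N
  archimedean x with 0# ≤? x
  ... | no  0≰x = 0 , proj₁ (≰⇒> 0≰x)
  ... | yes 0≤x = from-sup (complete Below (0# , lift 0≤x , 0 , refl) (x , λ { (lift y≤x , _) → y≤x }))
    where
    Below : Carrier → Set (c ⊔ ℓ₁ ⊔ ℓ₂)
    Below y = Lift (c ⊔ ℓ₁ ⊔ ℓ₂) (y ≤ x) × ∃[ n ] y ≈ fromℕ n

    from-sup : ∃[ s ] IsSup Below s → ∃[ N ] x ≤ fromℕ N
    from-sup (s , ub , approx) with approx {s - 1#} s-1<s
      where
      s-1<s : s - 1# < s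
      s-1<s = 0≤-⇒≤ (0≤-resp (solve 1 (λ s → :1 := s :- (s :- :1)) refl s) 0≤1) ,
        λ s-1≈s → 0≉1 (sym (≈-by (- 1#) s-1≈s
          (solve 1 (λ s → :1 := :0 :+ (:- :1) :* ((s :- :1) :- s)) refl s)))
    ... | y , (_ , n , y≈n) , s-1≤y , s-1≉y with x ≤? fromℕ (suc n)
    ...   | yes x≤N = suc n , x≤N
    ...   | no  x≰N = contradiction (antisym s-1≤y y≤s-1) s-1≉y
      where
      N≤s : fromℕ (suc n) ≤ s
      N≤s = ub (lift (proj₁ (≰⇒> x≰N)) , suc n , refl)
      y≤s-1 : y ≤ s - 1#
      y≤s-1 = 0≤-⇒≤ (0≤-resp
        (trans (+-congˡ (-‿cong (+-congˡ (sym y≈n))))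
          (solve 2 (λ s y → s :- (:1 :+ y) := (s :- :1) :- y) refl s y))
        (≤⇒0≤- N≤s))

  fromℕ-mono : ∀ {m n} → m ℕ.≤ n → fromℕ m ≤ fromℕ n
  fromℕ-mono {n = n} z≤n = fromℕ-nonneg n
  fromℕ-mono (s≤s m≤n)   = +-monoʳ-≤ 1# (fromℕ-mono m≤n)

  open Sum semiring public using (sum-cong-≋; ∑-distrib-+; *-distribˡ-sum; sum-replicate-zero)

  sum-axpy : ∀ {n} e {f g h : Vector Carrier n} → (∀ i → h i ≈ f i + e * g i) →
             sum h ≈ sum f + e * sum g
  sum-axpy e {f} {g} h≈ = trans (sum-cong-≋ h≈)
    (trans (∑-distrib-+ f (λ i → e * g i)) (+-congˡ (sym (*-distribˡ-sum e g))))

  sum-nonneg : ∀ {n} {f : Vector Carrier n} → (∀ i → 0# ≤ f i) → 0# ≤ sum f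
  sum-nonneg {zero}  0≤f = ≤-refl
  sum-nonneg {suc n} 0≤f = +-nonneg (0≤f Fin.zero) (sum-nonneg (λ i → 0≤f (Fin.suc i)))

-- Generating functions and their products

-- A sequence f stands for its generating function Σ f k zᵏ.
module GeneratingFunctions {c ℓ₁ ℓ₂} (R : CompleteOrderedField c ℓ₁ ℓ₂) where
  open OrderedField R
  open SetoidReasoning setoid

  infix 4 _≐_
  _≐_ : (f g : ℕ → Carrier) → Set ℓ₁
  f ≐ g = ∀ k → f k ≈ g k

  -- Multiplication by z.
  shift : (ℕ → Carrier) → ℕ → Carrier
  shift f zero    = 0#
  shift f (suc k) = f k

  -- Multiplication by 1 + ε z.
  D : Carrier → (ℕ → Carrier) → ℕ → Carrier
  D ε f k = f k + ε * shift f k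

  δ : ℕ → Carrier
  δ zero    = 1#
  δ (suc k) = 0#

  D-cong : ∀ {ε f g} → f ≐ g → D ε f ≐ D ε g
  D-cong f≐g zero    = +-congʳ (f≐g 0)
  D-cong f≐g (suc k) = +-cong (f≐g (suc k)) (*-congˡ (f≐g k))

  -- The coefficients of (1 − z)ⁱ (1 + z)ᵐ.
  P : ℕ → ℕ → ℕ → Carrier
  P zero    zero    = δ
  P zero    (suc m) = D 1# (P zero m)
  P (suc i) m       = D (- 1#) (P i m)

  convTerm : (f g : ℕ → Carrier) → ∀ k → Vector Carrier (suc k)
  convTerm f g k j = f (toℕ j) * g (k ∸ toℕ j)

  -- The Cauchy product. `K R n k x` unfolds to the convolution of `signedBinom x` with
  -- `binom R (fromℕ n - x)`.
  conv : (f g : ℕ → Carrier) → ℕ → Carrier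
  conv f g k = sum (convTerm f g k)

  conv-congˡ : ∀ {f f′} g → f ≐ f′ → conv f g ≐ conv f′ g
  conv-congˡ {f} {f′} g f≐f′ k = sum-cong-≋ {x = convTerm f g k} {convTerm f′ g k} (λ j → *-congʳ (f≐f′ (toℕ j)))

  conv-D : ∀ ε f g → conv (D ε f) g ≐ D ε (conv f g)
  conv-D ε f g zero = solve 3 (λ ε f g →
    (f :+ ε :* :0) :* g :+ :0 := (f :* g :+ :0) :+ ε :* :0) refl ε (f 0) (g 0)
  conv-D ε f g (suc k) = begin
    (f 0 + ε * 0#) * g (suc k) + conv (λ j → D ε f (suc j)) g k
      ≈⟨ +-congˡ (sum-axpy ε {convTerm f⁺ g k} {convTerm f g k} (λ (j : Fin (suc k)) → solve 4 (λ ε a b g →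
           (a :+ ε :* b) :* g := a :* g :+ ε :* (b :* g))
           refl ε (f (suc (toℕ j))) (f (toℕ j)) (g (k ∸ toℕ j)))) ⟩
    (f 0 + ε * 0#) * g (suc k) + (conv f⁺ g k + ε * conv f g k)
      ≈⟨ solve 5 (λ ε a b s t → (a :+ ε :* :0) :* b :+ (s :+ ε :* t) := (a :* b :+ s) :+ ε :* t)
           refl ε (f 0) (g (suc k)) (conv f⁺ g k) (conv f g k) ⟩
    D ε (conv f g) (suc k) ∎
    where
    f⁺ : ℕ → Carrier
    f⁺ j = f (suc j)

  conv-δ : ∀ g → conv δ g ≐ g
  conv-δ g k = begin
    conv δ g k ≈⟨ tail k ⟩
    1# * g k   ≈⟨ *-identityˡ (g k) ⟩
    g k        ∎
    where
    tail : ∀ k → conv δ g k ≈ 1# * g k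
    tail zero    = +-identityʳ _
    tail (suc k) = trans
      (+-congˡ (trans (sum-cong-≋ {x = convTerm (λ _ → 0#) g k} {λ _ → 0#} (λ j → zeroˡ (g (k ∸ toℕ j)))) (sum-replicate-zero (suc k))))
      (+-identityʳ _)

  -- A degree bound for the generating function.
  VanishesAbove : ℕ → (ℕ → Carrier) → Set ℓ₁
  VanishesAbove n f = ∀ {k} → n ℕ.< k → f k ≈ 0#

  D-vanishes : ∀ ε {n f} → VanishesAbove n f → VanishesAbove (suc n) (D ε f)
  D-vanishes ε f≈0 {suc k} (s≤s n<k) = trans
    (+-cong (f≈0 (ℕ.m<n⇒m<1+n n<k)) (*-congˡ (f≈0 n<k)))
    (solve 1 (λ ε → :0 :+ ε :* :0 := :0) refl ε)

  P-vanishes : ∀ i m → VanishesAbove (i ℕ.+ m) (P i m)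
  P-vanishes zero    zero    {suc k} _ = refl
  P-vanishes zero    (suc m) = D-vanishes 1# (P-vanishes zero m)
  P-vanishes (suc i) m       = D-vanishes (- 1#) (P-vanishes i m)

  P-zero : ∀ i m → P i m 0 ≈ 1#
  P-zero zero    zero    = refl
  P-zero zero    (suc m) = trans (solve 1 (λ x → x :+ :1 :* :0 := x) refl (P 0 m 0)) (P-zero zero m)
  P-zero (suc i) m       = trans (solve 1 (λ x → x :+ (:- :1) :* :0 := x) refl (P i m 0)) (P-zero i m)

  -- Homogenised evaluation of a polynomial at p and q

  module _ (p q : Carrier) where

    weightedTerm : ∀ n → (ℕ → Carrier) → Vector Carrier (suc n)
    weightedTerm n f k = f (toℕ k) * (p ^ toℕ k * q ^ (n ∸ toℕ k))

    -- For F of degree at most n this is qⁿ F(p/q), in a form that makes sense for q = 0, the value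
    -- used when a ≥ 1/4.
    weightedSum : ℕ → (ℕ → Carrier) → Carrier
    weightedSum n f = sum (weightedTerm n f)

    weightedSum-axpy : ∀ n e {f g h} → (∀ k → h k ≈ f k + e * g k) →
                       weightedSum n h ≈ weightedSum n f + e * weightedSum n g
    weightedSum-axpy n e {f} {g} {h} h≈ = sum-axpy e {weightedTerm n f} {weightedTerm n g} (λ k → trans (*-congʳ (h≈ (toℕ k)))
      (solve 4 (λ a b e w → (a :+ e :* b) :* w := a :* w :+ e :* (b :* w))
        refl (f (toℕ k)) (g (toℕ k)) e (p ^ toℕ k * q ^ (n ∸ toℕ k))))

    weightedSum-first : ∀ n f → weightedSum (suc n) f ≈
                        f 0 * q ^ suc n + p * weightedSum n (λ k → f (suc k))
    weightedSum-first n f = +-cong (*-congˡ (*-identityˡ _)) (trans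
      (sum-cong-≋ {x = λ k → weightedTerm (suc n) f (Fin.suc k)} {λ k → p * weightedTerm n f⁺ k} (λ k → solve 4 (λ f p u v → f :* ((p :* u) :* v) := p :* (f :* (u :* v)))
        refl (f (suc (toℕ k))) p (p ^ toℕ k) (q ^ (n ∸ toℕ k))))
      (sym (*-distribˡ-sum p (weightedTerm n f⁺))))
      where
      f⁺ : ℕ → Carrier
      f⁺ k = f (suc k)

    weightedSum-last : ∀ n f → weightedSum (suc n) f ≈ q * weightedSum n f + f (suc n) * p ^ suc n
    weightedSum-last zero f = solve 4 (λ p q a b →
      a :* (:1 :* (q :* :1)) :+ (b :* ((p :* :1) :* :1) :+ :0)
        := q :* (a :* (:1 :* :1) :+ :0) :+ b :* (p :* :1)) refl p q (f 0) (f 1)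
    weightedSum-last (suc n) f = begin
      weightedSum (suc (suc n)) f
        ≈⟨ weightedSum-first (suc n) f ⟩
      f 0 * (q * q ^ suc n) + p * weightedSum (suc n) f⁺
        ≈⟨ +-congˡ (*-congˡ (weightedSum-last n f⁺)) ⟩
      f 0 * (q * q ^ suc n) + p * (q * weightedSum n f⁺ + f⁺ (suc n) * p ^ suc n)
        ≈⟨ solve 7 (λ p q a u s b v → a :* (q :* u) :+ p :* (q :* s :+ b :* v)
             := q :* (a :* u :+ p :* s) :+ b :* (p :* v))
             refl p q (f 0) (q ^ suc n) (weightedSum n f⁺) (f⁺ (suc n)) (p ^ suc n) ⟩
      q * (f 0 * q ^ suc n + p * weightedSum n f⁺) + f⁺ (suc n) * (p * p ^ suc n)
        ≈⟨ +-congʳ (*-congˡ (weightedSum-first n f)) ⟨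
      q * weightedSum (suc n) f + f (suc (suc n)) * p ^ suc (suc n) ∎
      where
      f⁺ : ℕ → Carrier
      f⁺ k = f (suc k)

    -- The factor 1 + ε z homogenises to q + ε p. Peeling off the first term isolates the shift,
    -- peeling off the last lowers the degree, and the leftover coefficient `f (suc n)` is zero by
    -- the degree bound.
    weightedSum-D : ∀ n ε {f} → VanishesAbove n f →
                    weightedSum (suc n) (D ε f) ≈ (q + ε * p) * weightedSum n f
    weightedSum-D n ε {f} f≈0 = begin
      weightedSum (suc n) (D ε f)
        ≈⟨ weightedSum-first n (D ε f) ⟩
      (f 0 + ε * 0#) * q ^ suc n + p * weightedSum n (λ k → D ε f (suc k))
        ≈⟨ +-congˡ (*-congˡ (weightedSum-axpy n ε {λ k → f (suc k)} {f} (λ k → refl))) ⟩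
      (f 0 + ε * 0#) * q ^ suc n + p * (weightedSum n (λ k → f (suc k)) + ε * weightedSum n f)
        ≈⟨ solve 6 (λ a ε u p s t → (a :+ ε :* :0) :* u :+ p :* (s :+ ε :* t)
             := (a :* u :+ p :* s) :+ ε :* p :* t)
             refl (f 0) ε (q ^ suc n) p (weightedSum n (λ k → f (suc k))) (weightedSum n f) ⟩
      (f 0 * q ^ suc n + p * weightedSum n (λ k → f (suc k))) + ε * p * weightedSum n f
        ≈⟨ +-congʳ (weightedSum-first n f) ⟨
      weightedSum (suc n) f + ε * p * weightedSum n f
        ≈⟨ +-congʳ (weightedSum-last n f) ⟩
      (q * weightedSum n f + f (suc n) * p ^ suc n) + ε * p * weightedSum n f
        ≈⟨ +-congʳ (+-congˡ (*-congʳ (f≈0 (ℕ.n<1+n n)))) ⟩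
      (q * weightedSum n f + 0# * p ^ suc n) + ε * p * weightedSum n f
        ≈⟨ solve 5 (λ q s u ε p → (q :* s :+ :0 :* u) :+ ε :* p :* s := (q :+ ε :* p) :* s)
             refl q (weightedSum n f) (p ^ suc n) ε p ⟩
      (q + ε * p) * weightedSum n f ∎

    -- Each factor 1 + z contributes q + p = 1 and each factor 1 - z contributes q - p.
    weightedSum-P : p + q ≈ 1# → ∀ i m → weightedSum (i ℕ.+ m) (P i m) ≈ (q - p) ^ i
    weightedSum-P p+q≈1 zero zero = solve 0 (:1 :* (:1 :* :1) :+ :0 := :1) refl
    weightedSum-P p+q≈1 zero (suc m) = begin
      weightedSum (suc m) (D 1# (P 0 m))        ≈⟨ weightedSum-D m 1# (P-vanishes 0 m) ⟩
      (q + 1# * p) * weightedSum m (P 0 m)      ≈⟨ *-cong q+p≈1 (weightedSum-P p+q≈1 zero m) ⟩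
      1# * 1#                                   ≈⟨ *-identityˡ 1# ⟩
      1#                                        ∎
      where
      q+p≈1 : q + 1# * p ≈ 1#
      q+p≈1 = trans (trans (+-congˡ (*-identityˡ p)) (+-comm q p)) p+q≈1
    weightedSum-P p+q≈1 (suc i) m = trans (weightedSum-D (i ℕ.+ m) (- 1#) (P-vanishes i m))
      (*-cong (solve 2 (λ p q → q :+ (:- :1) :* p := q :- p) refl p q) (weightedSum-P p+q≈1 i m))

  -- Generalized binomial coefficients and Krawtchouk values

  ↓-cong : ∀ {x y} j → x ≈ y → _↓_ R x j ≈ _↓_ R y j
  ↓-cong zero    x≈y = refl
  ↓-cong (suc j) x≈y = *-cong (↓-cong j x≈y) (+-congʳ x≈y)

  binom-cong : ∀ {x y} j → x ≈ y → binom R x j ≈ binom R y j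
  binom-cong j x≈y = *-congʳ (↓-cong j x≈y)

  -- The falling factorial recurses on its last factor, whereas Pascal's rule needs the first one
  -- split off.
  ↓-suc : ∀ x j → _↓_ R (1# + x) (suc j) ≈ (1# + x) * _↓_ R x j
  ↓-suc x zero    = solve 1 (λ x → :1 :* ((:1 :+ x) :- :0) := (:1 :+ x) :* :1) refl x
  ↓-suc x (suc j) = trans (*-congʳ (↓-suc x j))
    (solve 3 (λ x d n → (:1 :+ x) :* d :* ((:1 :+ x) :- (:1 :+ n)) := (:1 :+ x) :* (d :* (x :- n)))
      refl x (_↓_ R x j) (fromℕ j))

  0↓suc : ∀ j → _↓_ R 0# (suc j) ≈ 0#
  0↓suc zero    = solve 0 (:1 :* (:0 :- :0) := :0) refl
  0↓suc (suc j) = trans (*-congʳ (0↓suc j)) (zeroˡ _)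

  fromℕ-!-pos : ∀ n → 0# < fromℕ (n !)
  fromℕ-!-pos zero    = fromℕ-pos 0
  fromℕ-!-pos (suc n) = <-≤-trans (*-pos (fromℕ-pos n) (fromℕ-!-pos n))
    (≤-reflexive (sym (×1-homo-* (suc n) (n !))))

  binom-zero : ∀ x → binom R x 0 ≈ 1#
  binom-zero x = trans (*-congʳ (sym (+-identityʳ 1#))) (inverseʳ (fromℕ-pos 0))

  binom-0 : binom R 0# ≐ δ
  binom-0 zero    = binom-zero 0#
  binom-0 (suc j) = trans (*-congʳ (0↓suc j)) (zeroˡ _)

  pascal : ∀ x → binom R (1# + x) ≐ D 1# (binom R x)
  pascal x zero = trans (binom-zero (1# + x)) (trans (sym (binom-zero x))
    (solve 1 (λ b → b := b :+ :1 :* :0) refl (binom R x 0)))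
  pascal x (suc j) = begin
    _↓_ R (1# + x) (suc j) * h′        ≈⟨ *-congʳ (↓-suc x j) ⟩
    -- Splits 1 + x as (x - j) + (1 + j); the second part cancels a factor of (j + 1)!.
    (1# + x) * d * h′                  ≈⟨ solve 4 (λ x d n h → (:1 :+ x) :* d :* h
                                            := d :* (x :- n) :* h :+ d :* ((:1 :+ n) :* h)) refl x d (fromℕ j) h′ ⟩
    d * (x - fromℕ j) * h′ + d * (fromℕ (suc j) * h′)
                                       ≈⟨ +-congˡ (*-congˡ j+1*h′≈h) ⟩
    d * (x - fromℕ j) * h′ + d * h     ≈⟨ +-congˡ (*-identityˡ _) ⟨
    D 1# (binom R x) (suc j)           ∎
    where
    d h h′ : Carrier
    d  = _↓_ R x j
    h  = fromℕ (j !) ⁻¹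
    h′ = fromℕ (suc j !) ⁻¹
    j+1*h′≈h : fromℕ (suc j) * h′ ≈ h
    j+1*h′≈h = begin
      fromℕ (suc j) * h′
        ≈⟨ *-identityʳ _ ⟨
      fromℕ (suc j) * h′ * 1#
        ≈⟨ *-congˡ (inverseʳ (fromℕ-!-pos j)) ⟨
      fromℕ (suc j) * h′ * (fromℕ (j !) * h)
        ≈⟨ solve 4 (λ n h′ f h → n :* h′ :* (f :* h) := (n :* f) :* h′ :* h) refl (fromℕ (suc j)) h′ (fromℕ (j !)) h ⟩
      fromℕ (suc j) * fromℕ (j !) * h′ * h
        ≈⟨ *-congʳ (*-congʳ (×1-homo-* (suc j) (j !))) ⟨
      fromℕ (suc j !) * h′ * h
        ≈⟨ *-congʳ (inverseʳ (fromℕ-!-pos (suc j))) ⟩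
      1# * h
        ≈⟨ *-identityˡ h ⟩
      h ∎

  signedBinom : Carrier → ℕ → Carrier
  signedBinom x j = (- 1#) ^ j * binom R x j

  signedBinom-0 : signedBinom 0# ≐ δ
  signedBinom-0 zero    = trans (*-identityˡ _) (binom-0 0)
  signedBinom-0 (suc j) = trans (*-congˡ (binom-0 (suc j))) (zeroʳ _)

  signedPascal : ∀ x → signedBinom (1# + x) ≐ D (- 1#) (signedBinom x)
  signedPascal x zero = trans (*-congˡ (pascal x 0))
    (solve 1 (λ b → :1 :* (b :+ :1 :* :0) := :1 :* b :+ (:- :1) :* :0) refl (binom R x 0))
  signedPascal x (suc j) = trans (*-congˡ (pascal x (suc j)))
    (solve 3 (λ b b′ u → ((:- :1) :* u) :* (b′ :+ :1 :* b) := ((:- :1) :* u) :* b′ :+ (:- :1) :* (u :* b))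
      refl (binom R x j) (binom R x (suc j)) ((- 1#) ^ j))

  binom-fromℕ : ∀ m → binom R (fromℕ m) ≐ P 0 m
  binom-fromℕ zero      = binom-0
  binom-fromℕ (suc m) k = trans (pascal (fromℕ m) k) (D-cong (binom-fromℕ m) k)

  conv-signedBinom : ∀ i {m g} → g ≐ P 0 m → conv (signedBinom (fromℕ i)) g ≐ P i m
  conv-signedBinom zero    {g = g} g≐ k =
    trans (conv-congˡ g signedBinom-0 k) (trans (conv-δ g k) (g≐ k))
  conv-signedBinom (suc i) {g = g} g≐ k =
    trans (conv-congˡ g (signedPascal (fromℕ i)) k) (trans (conv-D (- 1#) (signedBinom (fromℕ i)) g k)
      (D-cong (conv-signedBinom i g≐) k))

  -- The convolution in `K` multiplies the series of (1 - z)ⁱ and (1 + z)ⁿ⁻ⁱ. Writing n as `i ℕ.+ m`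
  -- avoids truncated subtraction.
  K≈P : ∀ i m k → K R (i ℕ.+ m) k (fromℕ i) ≈ P i m k
  K≈P i m = conv-signedBinom i (λ k → trans (binom-cong k n-i≈m) (binom-fromℕ m k))
    where
    n-i≈m : fromℕ (i ℕ.+ m) - fromℕ i ≈ fromℕ m
    n-i≈m = trans (+-congʳ (×-homo-+ 1# i m))
      (solve 2 (λ i m → (i :+ m) :- i := m) refl (fromℕ i) (fromℕ m))

  -- Needed because `fromℕ 1` is `1# + 0#`, which equals `1#` only up to `≈`.
  K-cong : ∀ n k {x y} → x ≈ y → K R n k x ≈ K R n k y
  K-cong n k {x} {y} x≈y = sum-cong-≋
    {x = convTerm (signedBinom x) (binom R (fromℕ n - x)) k}
    {convTerm (signedBinom y) (binom R (fromℕ n - y)) k} (λ j → *-cong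
    (*-congˡ (binom-cong (toℕ j) x≈y))
    (binom-cong (k ∸ toℕ j) (+-congˡ (-‿cong x≈y))))

  -- Signs and absorption identities for ordinary binomial coefficients

  P-nonneg : ∀ m k → 0# ≤ P 0 m k
  P-nonneg zero    zero    = 0≤1
  P-nonneg zero    (suc k) = ≤-refl
  P-nonneg (suc m) zero    = +-nonneg (P-nonneg m 0) (0≤-resp (sym (zeroʳ 1#)) ≤-refl)
  P-nonneg (suc m) (suc k) = +-nonneg (P-nonneg m (suc k)) (0≤-resp (sym (*-identityˡ _)) (P-nonneg m k))

  shift-nonneg : ∀ {f} → (∀ k → 0# ≤ f k) → ∀ k → 0# ≤ shift f k
  shift-nonneg 0≤f zero    = ≤-refl
  shift-nonneg 0≤f (suc k) = 0≤f k

  -- Induction on n by Pascal's rule, using the previous row at both k + 1 and k; `shift` supplies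
  -- the value 0 of C(n, -1).
  absorption : ∀ n k → fromℕ (suc n) * shift (P 0 n) k ≈ fromℕ k * P 0 (suc n) k
  absorption n       zero = trans (zeroʳ _) (sym (zeroˡ _))
  absorption zero    (suc zero) = solve 0 ((:1 :+ :0) :* :1 := (:1 :+ :0) :* (:0 :+ :1 :* :1)) refl
  absorption zero    (suc (suc k)) = solve 1 (λ k → (:1 :+ :0) :* :0 := k :* (:0 :+ :1 :* :0)) refl (fromℕ (suc (suc k)))
  absorption (suc n) (suc k) = sym (begin
    (1# + x) * (b + 1# * u)
      ≈⟨ solve 3 (λ x b u → (:1 :+ x) :* (b :+ :1 :* u) := (:1 :+ x) :* b :+ (u :+ x :* u)) refl x b u ⟩
    (1# + x) * b + (u + x * u)
      ≈⟨ +-cong (absorption n (suc k)) (+-congˡ (absorption n k)) ⟨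
    (1# + y) * v + (u + (1# + y) * s)
      ≈⟨ solve 3 (λ y v s → (:1 :+ y) :* v :+ ((v :+ :1 :* s) :+ (:1 :+ y) :* s)
           := (:1 :+ (:1 :+ y)) :* (v :+ :1 :* s)) refl y v s ⟩
    (1# + (1# + y)) * u ∎)
    where
    x y b u v s : Carrier
    x = fromℕ k
    y = fromℕ n
    b = P 0 (suc n) (suc k)
    u = P 0 (suc n) k
    v = P 0 n k
    s = shift (P 0 n) k

  -- The complementary identity, from Pascal's rule minus `absorption`.
  absorption′ : ∀ n k → fromℕ (suc n) * P 0 n k ≈ (fromℕ (suc n) - fromℕ k) * P 0 (suc n) k
  absorption′ n k = ≈-by 1# (sym (absorption n k))
    (solve 4 (λ n k v s → n :* v := (n :- k) :* (v :+ :1 :* s) :+ :1 :* (k :* (v :+ :1 :* s) :- n :* s))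
      refl (fromℕ (suc n)) (fromℕ k) (P 0 n k) (shift (P 0 n) k))

-- Lower and upper bounds for the linear program

module LinearProgram {c ℓ₁ ℓ₂} (R : CompleteOrderedField c ℓ₁ ℓ₂) where
  open GeneratingFunctions R
  open OrderedField R
  open SetoidReasoning setoid

  -- Evaluating Σₖ Kₖ(i) pᵏ qⁿ⁻ᵏ = (q − p)ⁱ makes x_k = Y pᵏ qⁿ⁻ᵏ feasible: the absent term
  -- k = 0 cancels from the constraints, and its absence only increases the objective.
  module LowerBound
    (p q : Carrier) (0≤p : 0# ≤ p) (0≤q : 0# ≤ q) (p+q≈1 : p + q ≈ 1#)
    (Y : Carrier) (0≤Y : 0# ≤ Y)
    (bound : Y * ((p - q) + (p - q) * (p - q)) ≤ 1#) where

    z : Carrier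
    z = q - p

    weights : ∀ n → Vector Carrier n
    weights n j = Y * (p ^ suc (toℕ j) * q ^ (n ∸ suc (toℕ j)))

    weights-nonneg : ∀ n j → 0# ≤ weights n j
    weights-nonneg n j = *-nonneg 0≤Y (*-nonneg (^-nonneg 0≤p (suc (toℕ j))) (^-nonneg 0≤q (n ∸ suc (toℕ j))))

    KTerm : ∀ n → Carrier → Vector Carrier n
    KTerm n x j = K R n (suc (toℕ j)) x * weights n j

    -- The program has no variable with index 0, so the term k = 0 of the full weighted sum, which
    -- is qⁿ since `P i m 0` is 1, is subtracted.
    sum-K : ∀ {n} i → i ℕ.≤ n → sum (KTerm n (fromℕ i)) ≈ Y * (z ^ i - q ^ n)
    sum-K i i≤n with ℕ.m≤n⇒∃[o]m+o≡n i≤n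
    ... | m , ≡.refl = begin
      sum (KTerm (i ℕ.+ m) (fromℕ i))
        ≈⟨ sum-cong-≋ {x = KTerm (i ℕ.+ m) (fromℕ i)} {λ j → Y * weightedTerm p q n (P i m) (Fin.suc j)} (λ j → trans
             (*-congʳ (K≈P i m (suc (toℕ j))))
             (solve 3 (λ a Y w → a :* (Y :* w) := Y :* (a :* w)) refl (P i m (suc (toℕ j))) Y
               (p ^ suc (toℕ j) * q ^ (n ∸ suc (toℕ j))))) ⟩
      sum (λ j → Y * weightedTerm p q n (P i m) (Fin.suc j))
        ≈⟨ *-distribˡ-sum Y (λ j → weightedTerm p q n (P i m) (Fin.suc j)) ⟨
      Y * S
        ≈⟨ *-congˡ (solve 2 (λ S u → S := (:1 :* (:1 :* u) :+ S) :- u) refl S (q ^ n)) ⟩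
      Y * ((1# * (1# * q ^ n) + S) - q ^ n)
        ≈⟨ *-congˡ (+-congʳ (+-congʳ (*-congʳ (P-zero i m)))) ⟨
      Y * (weightedSum p q n (P i m) - q ^ n)
        ≈⟨ *-congˡ (+-congʳ (weightedSum-P p q p+q≈1 i m)) ⟩
      Y * (z ^ i - q ^ n) ∎
      where
      n : ℕ
      n = i ℕ.+ m
      S : Carrier
      S = sum (λ j → weightedTerm p q n (P i m) (Fin.suc j))

    sum-K1 : ∀ {n} → 1 ℕ.≤ n → sum (KTerm n 1#) ≈ Y * (z - q ^ n)
    sum-K1 {n} 1≤n = trans
      (sum-cong-≋ {x = KTerm n 1#} {KTerm n (fromℕ 1)} (λ j → *-congʳ (K-cong n (suc (toℕ j)) (sym (+-identityʳ 1#)))))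
      (trans (sum-K 1 1≤n) (*-congˡ (+-congʳ (*-identityʳ z))))

    t² : Carrier
    t² = (p - q) * (p - q)

    -- As z = q - p with p, q nonnegative and p + q = 1, both t² - z y and t² + z y are convex
    -- combinations of t² - y and t² + y. Iteration from y = z² bounds all powers from the second
    -- on.
    step : ∀ y → 0# ≤ t² - y → 0# ≤ t² + y → 0# ≤ t² - z * y × 0# ≤ t² + z * y
    step y 0≤- 0≤+ =
      0≤-resp (≈-by t² p+q≈1 (solve 4 (λ p q b y → q :* (b :- y) :+ p :* (b :+ y)
        := b :- (q :- p) :* y :+ b :* ((p :+ q) :- :1)) refl p q t² y))
        (+-nonneg (*-nonneg 0≤q 0≤-) (*-nonneg 0≤p 0≤+)) ,
      0≤-resp (≈-by t² p+q≈1 (solve 4 (λ p q b y → q :* (b :+ y) :+ p :* (b :- y)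
        := b :+ (q :- p) :* y :+ b :* ((p :+ q) :- :1)) refl p q t² y))
        (+-nonneg (*-nonneg 0≤q 0≤+) (*-nonneg 0≤p 0≤-))

    ∣z^i∣≤t² : ∀ d → 0# ≤ t² - z ^ (2 ℕ.+ d) × 0# ≤ t² + z ^ (2 ℕ.+ d)
    ∣z^i∣≤t² zero =
      0≤-resp (solve 2 (λ p q → :0 := (p :- q) :* (p :- q) :- (q :- p) :* ((q :- p) :* :1)) refl p q) ≤-refl ,
      0≤-resp (solve 2 (λ p q → (p :- q) :* (p :- q) :+ (p :- q) :* (p :- q)
        := (p :- q) :* (p :- q) :+ (q :- p) :* ((q :- p) :* :1)) refl p q)
        (+-nonneg (square-nonneg (p - q)) (square-nonneg (p - q)))
    ∣z^i∣≤t² (suc d) = step (z ^ (2 ℕ.+ d)) (proj₁ (∣z^i∣≤t² d)) (proj₂ (∣z^i∣≤t² d))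

    feasible : ∀ n → Feasible R n (weights n)
    feasible n = weights-nonneg n , constraint
      where
      constraint : ∀ i → 2 ℕ.≤ i → i ℕ.≤ n →
        - 1# ≤ ∑[ j < n ] ((K R n (suc (toℕ j)) 1# - K R n (suc (toℕ j)) (fromℕ i)) * weights n j)
      -- The slack of constraint i is the slack of constraint 2, nonnegative by `bound`, plus Y (t²
      -- - zⁱ).
      constraint (suc (suc d)) (s≤s (s≤s z≤n)) i≤n = 0≤-⇒≤ (0≤-resp eq
        (+-nonneg (≤⇒0≤- bound) (*-nonneg 0≤Y (proj₁ (∣z^i∣≤t² d)))))
        where
        i : ℕ
        i = suc (suc d)
        eq : (1# - Y * ((p - q) + t²)) + Y * (t² - z ^ i) ≈
             ∑[ j < n ] ((K R n (suc (toℕ j)) 1# - K R n (suc (toℕ j)) (fromℕ i)) * weights n j) - - 1#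
        eq = begin
          (1# - Y * ((p - q) + t²)) + Y * (t² - z ^ i)
            ≈⟨ solve 6 (λ p q Y b y u → (:1 :- Y :* ((p :- q) :+ b)) :+ Y :* (b :- y)
                 := (Y :* ((q :- p) :- u) :+ (:- :1) :* (Y :* (y :- u))) :- (:- :1))
                 refl p q Y t² (z ^ i) (q ^ n) ⟩
          (Y * (z - q ^ n) + - 1# * (Y * (z ^ i - q ^ n))) - - 1#
            ≈⟨ +-congʳ (+-cong (sum-K1 (ℕ.≤-trans (s≤s z≤n) i≤n)) (*-congˡ (sum-K i i≤n))) ⟨
          (sum (KTerm n 1#) + - 1# * sum (KTerm n (fromℕ i))) - - 1#
            ≈⟨ +-congʳ (sum-axpy (- 1#) {KTerm n 1#} {KTerm n (fromℕ i)} (λ j →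
                 solve 3 (λ a b w → (a :- b) :* w := a :* w :+ (:- :1) :* (b :* w)) refl
                   (K R n (suc (toℕ j)) 1#) (K R n (suc (toℕ j)) (fromℕ i)) (weights n j))) ⟨
          ∑[ j < n ] ((K R n (suc (toℕ j)) 1# - K R n (suc (toℕ j)) (fromℕ i)) * weights n j) - - 1# ∎

    objective-≥ : ∀ {n} a → 1 ℕ.≤ n → 0# ≤ 1# / a →
                  Y * ((1# / a - 1#) * (p - q) - 1#) ≤ objective R n a (weights n)
    -- The surplus is exactly Y qⁿ / a, the contribution of the absent term k = 0.
    objective-≥ {n} a 1≤n 0≤1/a = 0≤-⇒≤ (0≤-resp eq (*-nonneg 0≤Y (*-nonneg 0≤1/a (^-nonneg 0≤q n))))
      where
      C : Carrier
      C = 1# / a - 1#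
      eq : Y * (1# / a * q ^ n) ≈ objective R n a (weights n) - Y * (C * (p - q) - 1#)
      eq = begin
        Y * (1# / a * q ^ n)
          ≈⟨ solve 5 (λ Y A u p q → Y :* (A :* u)
               := (:- (Y :* (:1 :- u) :+ (A :- :1) :* (Y :* ((q :- p) :- u)))) :- Y :* ((A :- :1) :* (p :- q) :- :1))
               refl Y (1# / a) (q ^ n) p q ⟩
        - (Y * (1# - q ^ n) + C * (Y * (z - q ^ n))) - Y * (C * (p - q) - 1#)
          ≈⟨ +-congʳ (-‿cong (+-cong (sum-K {n} 0 z≤n) (*-congˡ (sum-K1 {n} 1≤n)))) ⟨
        - (sum (KTerm n 0#) + C * sum (KTerm n 1#)) - Y * (C * (p - q) - 1#)
          ≈⟨ +-congʳ (-‿cong (sum-axpy C {KTerm n 0#} {KTerm n 1#} (λ j →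
               solve 4 (λ a b C w → (a :+ b :* C) :* w := a :* w :+ C :* (b :* w)) refl
                 (K R n (suc (toℕ j)) 0#) (K R n (suc (toℕ j)) 1#) C (weights n j)))) ⟨
        objective R n a (weights n) - Y * (C * (p - q) - 1#) ∎

  -- Weak duality and the dual inequality in binomial coefficients

  -- Weak duality with multiplier w on the constraint i = 2.
  objective-≤ : ∀ {n} a w → 2 ℕ.≤ n → 0# ≤ w →
    (∀ k → suc k ℕ.≤ n → 0# ≤ w * (K R n (suc k) (fromℕ 2) - K R n (suc k) 1#) +
                              (K R n (suc k) 0# + K R n (suc k) 1# * (1# / a - 1#))) →
    ∀ x → Feasible R n x → objective R n a x ≤ w
  objective-≤ {n} a w 2≤n 0≤w dual x (0≤x , constraint) = 0≤-⇒≤ (0≤-resp eq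
    (+-nonneg (sum-nonneg {n} {reducedCost} (λ j → *-nonneg (dual (toℕ j) (Fin.toℕ<n j)) (0≤x j)))
              (*-nonneg 0≤w (≤⇒0≤- (constraint 2 ℕ.≤-refl 2≤n)))))
    where
    C : Carrier
    C = 1# / a - 1#
    K₀ K₁ K₂ costTerm constraintTerm reducedCost : Vector Carrier n
    K₀ j = K R n (suc (toℕ j)) 0#
    K₁ j = K R n (suc (toℕ j)) 1#
    K₂ j = K R n (suc (toℕ j)) (fromℕ 2)
    costTerm j = (K₀ j + K₁ j * C) * x j
    constraintTerm j = (K₁ j - K₂ j) * x j
    reducedCost j = (w * (K₂ j - K₁ j) + (K₀ j + K₁ j * C)) * x j
    eq : sum reducedCost + w * (sum constraintTerm - - 1#) ≈ w - objective R n a x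
    eq = begin
      sum reducedCost + w * (sum constraintTerm - - 1#)
        ≈⟨ +-congʳ (sum-axpy (- w) {costTerm} {constraintTerm} (λ j →
             solve 6 (λ w a b d C x → (w :* (d :- b) :+ (a :+ b :* C)) :* x
               := (a :+ b :* C) :* x :+ (:- w) :* ((b :- d) :* x)) refl w (K₀ j) (K₁ j) (K₂ j) C (x j))) ⟩
      (sum costTerm + - w * sum constraintTerm) + w * (sum constraintTerm - - 1#)
        ≈⟨ solve 3 (λ s t w → (s :+ (:- w) :* t) :+ w :* (t :- (:- :1)) := w :- (:- s)) refl
             (sum costTerm) (sum constraintTerm) w ⟩
      w - objective R n a x ∎

  -- The reduced cost at index k + 1 for n = m + 2, after expanding (1 - z)², (1 - z)(1 + z) and (1
  -- + z)² against the common factor (1 + z)ᵐ.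
  dualForm : ℕ → ℕ → Carrier → Carrier → Carrier
  dualForm m k w C = (1# + C) * P 0 m (suc k) + ((1# - w) + (1# - w)) * P 0 m k +
                     ((w + w) + 1# - C) * shift (P 0 m) k

  dualForm-≈ : ∀ m k w C →
    dualForm m k w C ≈ w * (K R (2 ℕ.+ m) (suc k) (fromℕ 2) - K R (2 ℕ.+ m) (suc k) 1#) +
                       (K R (2 ℕ.+ m) (suc k) 0# + K R (2 ℕ.+ m) (suc k) 1# * C)
  dualForm-≈ m k w C = begin
    dualForm m k w C
      ≈⟨ solve 5 (λ α β γ w C →
           (:1 :+ C) :* α :+ ((:1 :- w) :+ (:1 :- w)) :* β :+ ((w :+ w) :+ :1 :- C) :* γ
             := w :* (((α :+ (:- :1) :* β) :+ (:- :1) :* (β :+ (:- :1) :* γ))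
                  :- ((α :+ :1 :* β) :+ (:- :1) :* (β :+ :1 :* γ)))
                :+ (((α :+ :1 :* β) :+ :1 :* (β :+ :1 :* γ))
                  :+ ((α :+ :1 :* β) :+ (:- :1) :* (β :+ :1 :* γ)) :* C))
           refl (P 0 m (suc k)) (P 0 m k) (shift (P 0 m) k) w C ⟩
    w * (P 2 m (suc k) - P 1 (suc m) (suc k)) + (P 0 (2 ℕ.+ m) (suc k) + P 1 (suc m) (suc k) * C)
      ≈⟨ +-cong (*-congˡ (+-cong (K≈P 2 m (suc k)) (-‿cong K₁≈))) (+-cong (K≈P 0 (2 ℕ.+ m) (suc k)) (*-congʳ K₁≈)) ⟨
    w * (K R (2 ℕ.+ m) (suc k) (fromℕ 2) - K R (2 ℕ.+ m) (suc k) 1#) +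
      (K R (2 ℕ.+ m) (suc k) 0# + K R (2 ℕ.+ m) (suc k) 1# * C) ∎
    where
    K₁≈ : K R (2 ℕ.+ m) (suc k) 1# ≈ P 1 (suc m) (suc k)
    K₁≈ = trans (K-cong (2 ℕ.+ m) (suc k) (sym (+-identityʳ 1#))) (K≈P 1 (suc m) (suc k))

  module _ (m k : ℕ) where
    private
      b₀ b₁ b₂ : ℕ → Carrier
      b₀ = P 0 m
      b₁ = P 0 (1 ℕ.+ m)
      b₂ = P 0 (2 ℕ.+ m)
      N N₁ κ : Carrier
      N  = fromℕ (2 ℕ.+ m)
      N₁ = fromℕ (1 ℕ.+ m)
      κ  = fromℕ (suc k)

      chain : ∀ {A B b x y} → N₁ * A ≈ x * B → N * B ≈ y * b → N * N₁ * A ≈ x * y * b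
      chain {A} {B} {b} {x} {y} p q = ≈-by₂ N x p q
        (solve 7 (λ N N₁ A B b x y → N :* N₁ :* A
          := x :* y :* b :+ (N :* (N₁ :* A :- x :* B) :+ x :* (N :* B :- y :* b))) refl N N₁ A B b x y)

    -- With j = n − k and n = 2 + m these are C(n−2,k) : C(n−2,k−1) : C(n−2,k−2) = j(j−1) : kj : (k−1)k,
    -- scaled by C(n,k).
    α-ratio : N * N₁ * b₀ (suc k) ≈ (N₁ - κ) * (N - κ) * b₂ (suc k)
    α-ratio = chain (absorption′ m (suc k)) (absorption′ (suc m) (suc k))

    β-ratio : N * N₁ * b₀ k ≈ κ * (N - κ) * b₂ (suc k)
    β-ratio = chain (absorption m (suc k)) (absorption′ (suc m) (suc k))

    γ-ratio : N * N₁ * shift b₀ k ≈ fromℕ k * κ * b₂ (suc k)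
    γ-ratio = chain (absorption m k) (absorption (suc m) (suc k))

  -- Positivity of the quadratic form for large n

  module QuadraticForm (s ε : Carrier) (0≤s : 0# ≤ s) (2s≤1 : 0# ≤ 1# - (s + s))
                       (0≤ε : 0# ≤ ε) (ε≤1 : 0# ≤ 1# - ε) where

    -- With s² = a and θ = (1 - s)² / a one has s² (θ - 1) = r, while h is the effect of raising the
    -- multiplier by ε. For ε = 0 the leading part of the form is the square (j - r k)², only
    -- semidefinite; h makes it definite.
    r h κ₀ : Carrier
    r  = 1# - (s + s)
    h  = s * s * ε
    κ₀ = s * s * s * ε

    -- Linear in its arguments, so that it applies both to the three binomial coefficients and to
    -- the proportional products j (j - 1), k j, k (k - 1).
    form : Carrier → Carrier → Carrier → Carrier
    form x y z = x - ((r + h) + (r + h)) * y + (r * r + (h + h)) * z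

    two four eight : Carrier
    two   = 1# + 1#
    four  = two + two
    eight = four + four

    -- With ρ = r + h and κ = κ₀ (4 − s ε), the leading part of the form is (j − ρ k)² + κ k²,
    -- which is at least κ₀ (j + k)² / 8.
    form-nonneg : ∀ {j k} → 0# ≤ k → 0# ≤ j + k → eight ≤ κ₀ * (j + k) →
                  0# ≤ form ((j - 1#) * j) (k * j) ((k - 1#) * k)
    form-nonneg {j} {k} 0≤k 0≤n large = *-cancel-nonneg 0<8 (0≤-resp
      (solve 4 (λ s ε j k →
        let r     = :1 :- (s :+ s)
            h     = s :* s :* ε
            κ₀    = s :* s :* s :* ε
            two   = :1 :+ :1
            four  = two :+ two
            eight = four :+ four
            B     = :1 :- s :* ε
            1-ρ   = s :* (:1 :+ B)
            ρ     = r :+ h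
            X     = j :- ρ :* k
            Z     = X :- (:1 :+ ρ) :* k
        -- Since j + k = X + (1 + ρ) k and Z = X - (1 + ρ) k, one has (j + k)² + Z² = 2 X² + 2 (1 +
        -- ρ)² k². This extracts κ₀ (j + k)² from the leading part, and that square absorbs the
        -- linear term -8 (j + k).
        in κ₀ :* (Z :* Z) :+ (two :* (four :- κ₀) :* (X :* X)
             :+ two :* κ₀ :* (eight :+ four :* B :+ 1-ρ :* (two :+ :1 :+ ρ)) :* (k :* k))
             :+ (j :+ k) :* (κ₀ :* (j :+ k) :- eight)
             :+ eight :* (k :* s :* (two :* r :+ two :* B))
           := eight :* ((j :- :1) :* j :- (ρ :+ ρ) :* (k :* j) :+ (r :* r :+ (h :+ h)) :* ((k :- :1) :* k)))
        refl s ε j k)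
      (+-nonneg (+-nonneg (+-nonneg
        (*-nonneg 0≤κ₀ (square-nonneg Z))
        (+-nonneg
          (*-nonneg (*-nonneg 0≤2 0≤4-κ₀) (square-nonneg X))
          (*-nonneg (*-nonneg (*-nonneg 0≤2 0≤κ₀)
            (+-nonneg (+-nonneg 0≤8 (*-nonneg 0≤4 0≤B))
              (*-nonneg (*-nonneg 0≤s (+-nonneg 0≤1 0≤B)) (+-nonneg (+-nonneg 0≤2 0≤1) (+-nonneg 2s≤1 0≤h)))))
            (square-nonneg k))))
        (*-nonneg 0≤n (≤⇒0≤- large)))
        (*-nonneg 0≤8 (*-nonneg (*-nonneg 0≤k 0≤s) (+-nonneg (*-nonneg 0≤2 2s≤1) (*-nonneg 0≤2 0≤B))))))
      where
      X Z : Carrier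
      X = j - (r + h) * k
      Z = X - (1# + (r + h)) * k
      0<8 : 0# < eight
      0<8 = +-pos (+-pos (+-pos 0<1 0≤1) (+-nonneg 0≤1 0≤1)) (+-nonneg (+-nonneg 0≤1 0≤1) (+-nonneg 0≤1 0≤1))
      0≤2 : 0# ≤ two
      0≤2 = +-nonneg 0≤1 0≤1
      0≤4 : 0# ≤ four
      0≤4 = +-nonneg 0≤2 0≤2
      0≤8 : 0# ≤ eight
      0≤8 = +-nonneg 0≤4 0≤4
      0≤h : 0# ≤ h
      0≤h = *-nonneg (*-nonneg 0≤s 0≤s) 0≤ε
      0≤κ₀ : 0# ≤ κ₀
      0≤κ₀ = *-nonneg (*-nonneg (*-nonneg 0≤s 0≤s) 0≤s) 0≤ε
      0≤B : 0# ≤ 1# - s * ε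
      0≤B = 0≤-resp (solve 2 (λ s ε → (:1 :- (s :+ s)) :+ s :* (:1 :- ε) :+ s := :1 :- s :* ε) refl s ε)
        (+-nonneg (+-nonneg 2s≤1 (*-nonneg 0≤s ε≤1)) 0≤s)
      0≤4-κ₀ : 0# ≤ four - κ₀
      0≤4-κ₀ = 0≤-resp
        (solve 2 (λ s ε →
          let B = :1 :- s :* ε in
          (:1 :+ (:1 :+ :1)) :+ B :+ s :* ε :* (((:1 :- (s :+ s)) :+ s) :* (:1 :+ s))
            := ((:1 :+ :1) :+ (:1 :+ :1)) :- s :* s :* s :* ε) refl s ε)
        (+-nonneg (+-nonneg (+-nonneg 0≤1 0≤2) 0≤B)
          (*-nonneg (*-nonneg 0≤s 0≤ε) (*-nonneg (+-nonneg 2s≤1 0≤s) (+-nonneg 0≤1 0≤s))))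

  -- An inequality suffices to bound the supremum from below, and the explicit points may exceed the
  -- target by the absent term k = 0.
  Attainable : ℕ → Carrier → Carrier → Set _
  Attainable n a y = ∃[ x ] Feasible R n x × y ≤ objective R n a x

  -- The case a < 1/4, with s = √a

  module SmallA (a s : Carrier) (0<a : 0# < a) (0≤s : 0# ≤ s) (s²≈a : s * s ≈ a)
                (2s≤1 : 0# ≤ 1# - (s + s)) where

    θ₀ : Carrier
    θ₀ = (1# - s) ^ 2 / a

    0<s : 0# < s
    0<s = 0≤s , λ 0≈s → proj₂ 0<a (trans (sym (zeroˡ s)) (trans (*-congʳ 0≈s) s²≈a))

    0<1-s : 0# < 1# - s
    0<1-s = <-≤-trans (+-pos 0<s 2s≤1)
      (≤-reflexive (solve 1 (λ s → s :+ (:1 :- (s :+ s)) := :1 :- s) refl s))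

    0<2 : 0# < 1# + 1#
    0<2 = +-pos 0<1 0≤1

    -- Inverses are atoms for the ring solver; the relations s σ = 1, (1 - s) u = 1 and 2 H = 1 are
    -- supplied as cofactor hypotheses.
    σ u H : Carrier
    σ = s ⁻¹
    u = (1# - s) ⁻¹
    H = (1# + 1#) ⁻¹

    a⁻¹≈σ² : a ⁻¹ ≈ σ * σ
    a⁻¹≈σ² = ≈-by₂ (σ * σ) (- (a ⁻¹ * (s * σ + 1#))) as (inverseʳ 0<s)
      (solve 3 (λ s σ A → A := σ :* σ :+ (σ :* σ :* ((s :* s) :* A :- :1)
        :+ (:- (A :* (s :* σ :+ :1))) :* (s :* σ :- :1))) refl s σ (a ⁻¹))
      where
      as : s * s * a ⁻¹ ≈ 1#
      as = trans (*-congʳ s²≈a) (inverseʳ 0<a)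

    θ₀≈ : θ₀ ≈ (1# - s) * (1# - s) * (σ * σ)
    θ₀≈ = *-cong (*-congˡ (*-identityʳ _)) a⁻¹≈σ²

    0≤θ₀ : 0# ≤ θ₀
    0≤θ₀ = 0≤-resp (sym θ₀≈) (*-nonneg (square-nonneg _) (square-nonneg _))

    module Primal where
      -- The solution of p + q = 1 and p - q = t for the optimal t = s / (1 - s). The value Y = (1 -
      -- s)² / s is 1 / (t + t²), making constraint 2 tight. That q ≥ 0 amounts to 2 s ≤ 1.
      p q Y : Carrier
      p = u * H
      q = (1# - (s + s)) * (u * H)
      Y = (1# - s) * (1# - s) * σ

      0≤p : 0# ≤ p
      0≤p = *-nonneg (⁻¹-nonneg 0<1-s) (⁻¹-nonneg 0<2)

      p+q≈1 : p + q ≈ 1#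
      p+q≈1 = ≈-by₂ ((1# + 1#) * H) 1# (inverseʳ 0<1-s) (inverseʳ 0<2)
        (solve 3 (λ s u H → u :* H :+ (:1 :- (s :+ s)) :* (u :* H)
          := :1 :+ ((:1 :+ :1) :* H :* ((:1 :- s) :* u :- :1) :+ :1 :* ((:1 :+ :1) :* H :- :1))) refl s u H)

      t≈ : p - q ≈ s * u
      t≈ = ≈-by (s * u) (inverseʳ 0<2)
        (solve 3 (λ s u H → u :* H :- (:1 :- (s :+ s)) :* (u :* H)
          := s :* u :+ s :* u :* ((:1 :+ :1) :* H :- :1)) refl s u H)

      bound : Y * ((p - q) + (p - q) * (p - q)) ≤ 1#
      bound = ≤-reflexive (trans (*-congˡ (+-cong t≈ (*-cong t≈ t≈)))
        (≈-by₂ ((1# - s) * (1# - s) * (u + s * (u * u))) (1# + s * (1# - s) * u)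
          (inverseʳ 0<s) (inverseʳ 0<1-s)
          (solve 3 (λ s σ u → (:1 :- s) :* (:1 :- s) :* σ :* (s :* u :+ s :* u :* (s :* u))
            := :1 :+ ((:1 :- s) :* (:1 :- s) :* (u :+ s :* (u :* u)) :* (s :* σ :- :1)
                 :+ (:1 :+ s :* (:1 :- s) :* u) :* ((:1 :- s) :* u :- :1))) refl s σ u)))

      value : θ₀ ≈ Y * ((1# / a - 1#) * (p - q) - 1#)
      value = sym (trans
        (*-congˡ (+-congʳ (*-cong (+-congʳ (trans (*-identityˡ _) a⁻¹≈σ²)) t≈)))
        (trans (≈-by₂ (Y * (1# + u * s + σ * u)) (Y * σ * (1# + s)) (inverseʳ 0<s) (inverseʳ 0<1-s)
          (solve 3 (λ s σ u → (:1 :- s) :* (:1 :- s) :* σ :* ((σ :* σ :- :1) :* (s :* u) :- :1)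
            := (:1 :- s) :* (:1 :- s) :* (σ :* σ) :+ ((:1 :- s) :* (:1 :- s) :* σ :* (:1 :+ u :* s :+ σ :* u) :* (s :* σ :- :1)
                 :+ (:1 :- s) :* (:1 :- s) :* σ :* σ :* (:1 :+ s) :* ((:1 :- s) :* u :- :1))) refl s σ u))
          (sym θ₀≈)))

    attained : ∀ n → 2 ℕ.≤ n → Attainable n a θ₀
    attained n 2≤n = weights n , feasible n , ≤-resp (sym value) refl
      (objective-≥ a (ℕ.≤-trans (s≤s z≤n) 2≤n) (0≤-resp (sym (*-identityˡ _)) (⁻¹-nonneg 0<a)))
      where
      open Primal
      open LowerBound p q 0≤p (*-nonneg 2s≤1 0≤p) p+q≈1 Y
        (*-nonneg (square-nonneg _) (⁻¹-nonneg 0<s)) bound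

    module _ (ε : Carrier) (0<ε : 0# < ε) (ε≤1 : 0# ≤ 1# - ε) where
      open QuadraticForm s ε 0≤s 2s≤1 (proj₁ 0<ε) ε≤1

      C w : Carrier
      C = 1# / a - 1#
      w = θ₀ + ε

      -- The factor s² = a clears the denominators: s² (1 + C) = 1 and s² θ₀ = (1 - s)².
      S*dualForm : ∀ m k → s * s * dualForm m k w C ≈ form (P 0 m (suc k)) (P 0 m k) (shift (P 0 m) k)
      S*dualForm m k = ≈-by₂ (α - γ) ((γ + γ) - (β + β)) S*[1+C]≈1 S*θ₀≈
        (solve 7 (λ s ε θ C α β γ →
          let r = :1 :- (s :+ s)
              h = s :* s :* ε
              w = θ :+ ε
          in s :* s :* ((:1 :+ C) :* α :+ ((:1 :- w) :+ (:1 :- w)) :* β :+ ((w :+ w) :+ :1 :- C) :* γ)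
            := (α :- ((r :+ h) :+ (r :+ h)) :* β :+ (r :* r :+ (h :+ h)) :* γ)
               :+ ((α :- γ) :* (s :* s :* (:1 :+ C) :- :1)
               :+ ((γ :+ γ) :- (β :+ β)) :* (s :* s :* θ :- (:1 :- s) :* (:1 :- s))))
          refl s ε θ₀ C α β γ)
        where
        α β γ : Carrier
        α = P 0 m (suc k)
        β = P 0 m k
        γ = shift (P 0 m) k
        S*[1+C]≈1 : s * s * (1# + C) ≈ 1#
        S*[1+C]≈1 = trans (*-congʳ s²≈a)
          (trans (solve 2 (λ a A → a :* (:1 :+ (:1 :* A :- :1)) := a :* A) refl a (a ⁻¹)) (inverseʳ 0<a))
        S*θ₀≈ : s * s * θ₀ ≈ (1# - s) * (1# - s)
        S*θ₀≈ = trans (*-congʳ s²≈a) (≈-by ((1# - s) * (1# - s)) (inverseʳ 0<a)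
          (solve 3 (λ s a A → a :* ((:1 :- s) :* ((:1 :- s) :* :1) :* A)
            := (:1 :- s) :* (:1 :- s) :+ (:1 :- s) :* (:1 :- s) :* (a :* A :- :1)) refl s a (a ⁻¹)))

      -- By linearity the factor n (n - 1) passes to the arguments of `form`, where the ratio lemmas
      -- turn each binomial coefficient into C(n, κ) times a quadratic in j and κ.
      N*S*dualForm : ∀ m k → let N = fromℕ (2 ℕ.+ m) ; κ = fromℕ (suc k) ; j = N - κ in
        N * fromℕ (1 ℕ.+ m) * (s * s * dualForm m k w C) ≈
        P 0 (2 ℕ.+ m) (suc k) * form ((j - 1#) * j) (κ * j) ((κ - 1#) * κ)
      N*S*dualForm m k = begin
        N * N₁ * (s * s * dualForm m k w C)
          ≈⟨ *-congˡ (S*dualForm m k) ⟩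
        N * N₁ * form (P 0 m (suc k)) (P 0 m k) (shift (P 0 m) k)
          ≈⟨ solve 6 (λ M x y z A B → M :* (x :- A :* y :+ B :* z) := M :* x :- A :* (M :* y) :+ B :* (M :* z))
               refl (N * N₁) (P 0 m (suc k)) (P 0 m k) (shift (P 0 m) k) A B ⟩
        form (N * N₁ * P 0 m (suc k)) (N * N₁ * P 0 m k) (N * N₁ * shift (P 0 m) k)
          ≈⟨ +-cong (+-cong (α-ratio m k) (-‿cong (*-congˡ (β-ratio m k)))) (*-congˡ (γ-ratio m k)) ⟩
        form ((N₁ - κ) * (N - κ) * b) (κ * (N - κ) * b) (fromℕ k * κ * b)
          ≈⟨ solve 5 (λ N₁ k b A B →
               let N = :1 :+ N₁
                   κ = :1 :+ k
                   j = N :- κ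
               in (N₁ :- κ) :* (N :- κ) :* b :- A :* (κ :* (N :- κ) :* b) :+ B :* (k :* κ :* b)
                 := b :* ((j :- :1) :* j :- A :* (κ :* j) :+ B :* ((κ :- :1) :* κ))) refl N₁ (fromℕ k) b A B ⟩
        b * form ((j - 1#) * j) (κ * j) ((κ - 1#) * κ) ∎
        where
        N N₁ κ j b A B : Carrier
        N  = fromℕ (2 ℕ.+ m)
        N₁ = fromℕ (1 ℕ.+ m)
        κ  = fromℕ (suc k)
        j  = N - κ
        b  = P 0 (2 ℕ.+ m) (suc k)
        A  = (r + h) + (r + h)
        B  = r * r + (h + h)

      dualForm-nonneg : ∀ m k → eight ≤ κ₀ * fromℕ (2 ℕ.+ m) → 0# ≤ dualForm m k w C
      dualForm-nonneg m k large =
        *-cancel-nonneg (*-pos 0<s 0<s) (*-cancel-nonneg (*-pos (fromℕ-pos (suc m)) (fromℕ-pos m))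
          (0≤-resp (sym (N*S*dualForm m k)) (*-nonneg (P-nonneg (2 ℕ.+ m) (suc k))
            (form-nonneg (fromℕ-nonneg (suc k))
              (0≤-resp N≈j+κ (fromℕ-nonneg (2 ℕ.+ m)))
              (≤-resp refl (*-congˡ N≈j+κ) large)))))
        where
        N≈j+κ : fromℕ (2 ℕ.+ m) ≈ (fromℕ (2 ℕ.+ m) - fromℕ (suc k)) + fromℕ (suc k)
        N≈j+κ = solve 2 (λ n k → n := (n :- k) :+ k) refl (fromℕ (2 ℕ.+ m)) (fromℕ (suc k))

      0<κ₀ : 0# < κ₀
      0<κ₀ = *-pos (*-pos (*-pos 0<s 0<s) 0<s) 0<ε

      threshold : ∃[ N ] eight * κ₀ ⁻¹ ≤ fromℕ N
      threshold = archimedean (eight * κ₀ ⁻¹)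

      bounded : ∃[ N ] ∀ n → N ℕ.≤ n → 2 ℕ.≤ n → ∀ x → Feasible R n x → objective R n a x ≤ θ₀ + ε
      bounded = proj₁ threshold , upper
        where
        large : ∀ n → proj₁ threshold ℕ.≤ n → eight ≤ κ₀ * fromℕ n
        large n N≤n = 0≤-⇒≤ (0≤-resp
          (≈-by (- eight) (inverseʳ 0<κ₀)
            (solve 4 (λ κ N e i → κ :* (N :- e :* i) := (κ :* N :- e) :+ (:- e) :* (κ :* i :- :1))
              refl κ₀ (fromℕ n) eight (κ₀ ⁻¹)))
          (*-nonneg (proj₁ 0<κ₀) (≤⇒0≤- (≤-trans (proj₂ threshold) (fromℕ-mono N≤n)))))
        upper : ∀ n → proj₁ threshold ℕ.≤ n → 2 ℕ.≤ n → ∀ x → Feasible R n x → objective R n a x ≤ w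
        upper (suc (suc m)) N≤n 2≤n@(s≤s (s≤s _)) = objective-≤ a w 2≤n (+-nonneg 0≤θ₀ (proj₁ 0<ε)) (λ k _ →
          0≤-resp (dualForm-≈ m k w C) (dualForm-nonneg m k (large (suc (suc m)) N≤n)))

  -- The case 1/4 ≤ a ≤ 1/2

  -- In the case a ≥ 1/4 the dual certificate is exact, with x supported at k = n.
  module LargeA (a : Carrier) (0<a : 0# < a) (1/4≤a : 1# / fromℕ 4 ≤ a) (a≤1/2 : a ≤ 1# / fromℕ 2) where

    θ₀ C g : Carrier
    θ₀ = 1# / (fromℕ 2 * a) - 1#
    C  = 1# / a - 1#
    g  = (fromℕ 2 * a) ⁻¹

    0<2a : 0# < fromℕ 2 * a
    0<2a = *-pos (fromℕ-pos 1) 0<a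

    a⁻¹≈2g : a ⁻¹ ≈ g + g
    a⁻¹≈2g = ≈-by₂ (g + g) (- (a ⁻¹)) (inverseʳ 0<a) (inverseʳ 0<2a)
      (solve 3 (λ a A g → A := (g :+ g) :+ ((g :+ g) :* (a :* A :- :1)
        :+ (:- A) :* ((:1 :+ (:1 :+ :0)) :* a :* g :- :1))) refl a (a ⁻¹) g)

    -- A dual multiplier must be nonnegative; this is where a ≤ 1/2 enters.
    0≤θ₀ : 0# ≤ θ₀
    0≤θ₀ = *-cancel-nonneg 0<2a (0≤-resp
      (≈-by (- 1#) (inverseʳ 0<2a)
        (solve 2 (λ a g → let two = :1 :+ (:1 :+ :0) in :1 :- two :* a
          := two :* a :* (:1 :* g :- :1) :+ (:- :1) :* (two :* a :* g :- :1)) refl a g))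
      (≤-reciprocal (fromℕ-pos 1) a≤1/2))

    -- This is where a ≥ 1/4 enters: it makes the middle coefficient 2 (1 - θ₀) of `dualForm`
    -- nonnegative.
    θ₀≤1 : 0# ≤ 1# - θ₀
    θ₀≤1 = *-cancel-nonneg 0<2a (0≤-resp
      (≈-by 1# (inverseʳ 0<2a)
        (solve 2 (λ a g → let two = :1 :+ (:1 :+ :0) in (:1 :+ (:1 :+ two)) :* a :- :1
          := two :* a :* (:1 :- (:1 :* g :- :1)) :+ :1 :* (two :* a :* g :- :1)) refl a g))
      (reciprocal-≤ (fromℕ-pos 3) 1/4≤a))

    0≤1/a : 0# ≤ 1# / a
    0≤1/a = 0≤-resp (sym (*-identityˡ _)) (⁻¹-nonneg 0<a)

    bounded : ∀ n → 2 ℕ.≤ n → ∀ x → Feasible R n x → objective R n a x ≤ θ₀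
    bounded (suc (suc m)) 2≤n@(s≤s (s≤s _)) = objective-≤ a θ₀ 2≤n 0≤θ₀ (λ k _ → 0≤-resp (dualForm-≈ m k θ₀ C)
      (+-nonneg (+-nonneg
        (*-nonneg (0≤-resp (solve 1 (λ x → x := :1 :+ (x :- :1)) refl (1# / a)) 0≤1/a) (P-nonneg m (suc k)))
        (*-nonneg (+-nonneg θ₀≤1 θ₀≤1) (P-nonneg m k)))
        (0≤-resp (sym (trans (*-congʳ γ-coefficient) (zeroˡ _))) ≤-refl)))
      where
      -- The multiplier θ₀ is the solution of 2 w + 1 = C, so the last coefficient of `dualForm`,
      -- the only one of uncertain sign, vanishes.
      γ-coefficient : (θ₀ + θ₀) + 1# - C ≈ 0#
      γ-coefficient = ≈-by (- 1#) a⁻¹≈2g (solve 2 (λ A g →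
        ((:1 :* g :- :1) :+ (:1 :* g :- :1)) :+ :1 :- (:1 :* A :- :1) := :0 :+ (:- :1) :* (A :- (g :+ g)))
        refl (a ⁻¹) g)

    attained : ∀ n → 2 ℕ.≤ n → Attainable n a θ₀
    attained n 2≤n = weights n , feasible n , ≤-resp value refl
      (objective-≥ a (ℕ.≤-trans (s≤s z≤n) 2≤n) 0≤1/a)
      where
      -- The point p = 1, q = 0 has t = 1, hence Y = 1 / (t + t²) = 1/2.
      H : Carrier
      H = (1# + 1#) ⁻¹
      2H≈1 : (1# + 1#) * H ≈ 1#
      2H≈1 = inverseʳ (+-pos 0<1 0≤1)
      bound : H * ((1# - 0#) + (1# - 0#) * (1# - 0#)) ≤ 1#
      bound = ≤-reflexive (trans
        (solve 1 (λ H → H :* ((:1 :- :0) :+ (:1 :- :0) :* (:1 :- :0)) := (:1 :+ :1) :* H) refl H) 2H≈1)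
      open LowerBound 1# 0# 0≤1 ≤-refl (+-identityʳ 1#) H (⁻¹-nonneg (+-pos 0<1 0≤1)) bound
      value : H * (C * (1# - 0#) - 1#) ≈ θ₀
      value = ≈-by₂ (g - 1#) H 2H≈1 a⁻¹≈2g (solve 3 (λ H A g →
        H :* ((:1 :* A :- :1) :* (:1 :- :0) :- :1)
          := (:1 :* g :- :1) :+ ((g :- :1) :* ((:1 :+ :1) :* H :- :1) :+ H :* (A :- (g :+ g)))) refl H (a ⁻¹) g)

  -- From the two bounds to the limit

  -- Eliminates the conditionals in `∣_∣` and `θ`; the explicit motive `Q` is a property of the
  -- resulting number.
  if-does : ∀ {b ℓ} {B : Set b} (Q : Carrier → Set ℓ) (B? : Dec B) {x y} →
            (B → Q x) → (¬ B → Q y) → Q (if does B? then x else y)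
  if-does Q (yes b) Qx Qy = Qx b
  if-does Q (no ¬b) Qx Qy = Qy ¬b

  ∣∣<-nonneg : ∀ {x ε} → 0# ≤ x → x < ε → ∣ x ∣ < ε
  ∣∣<-nonneg {x} {ε} 0≤x x<ε = if-does (_< ε) (0# ≤? x) (λ _ → x<ε) (λ 0≰x → contradiction 0≤x 0≰x)

  -- Half of min(ε, 1). Being below ε turns the bound v - L ≤ e into a strict one; being at most 1
  -- meets a hypothesis of `QuadraticForm`.
  small : ∀ {ε} → 0# < ε → ∃[ e ] 0# < e × e < ε × 0# ≤ 1# - e
  small {ε} 0<ε = choose (total ε 1#)
    where
    H : Carrier
    H = (1# + 1#) ⁻¹
    2H≈1 : (1# + 1#) * H ≈ 1#
    2H≈1 = inverseʳ (+-pos 0<1 0≤1)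
    0<H : 0# < H
    0<H = ⁻¹-nonneg (+-pos 0<1 0≤1) , λ 0≈H →
      0≉1 (trans (sym (zeroʳ (1# + 1#))) (trans (*-congˡ 0≈H) 2H≈1))
    half< : ∀ {x} → 0# < x → x * H < x
    half< {x} 0<x = ≤-resp (+-identityʳ _) xH+xH≈x (+-monoʳ-≤ (x * H) (proj₁ 0<xH)) ,
      λ xH≈x → proj₂ 0<xH (sym (≈-by₂ (- 1#) x xH≈x 2H≈1 (solve 2 (λ x H →
        x :* H := :0 :+ ((:- :1) :* (x :* H :- x) :+ x :* ((:1 :+ :1) :* H :- :1))) refl x H)))
      where
      0<xH : 0# < x * H
      0<xH = *-pos 0<x 0<H
      xH+xH≈x : x * H + x * H ≈ x
      xH+xH≈x = ≈-by x 2H≈1 (solve 2 (λ x H →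
        x :* H :+ x :* H := x :+ x :* ((:1 :+ :1) :* H :- :1)) refl x H)
    choose : ε ≤ 1# ⊎ 1# ≤ ε → ∃[ e ] 0# < e × e < ε × 0# ≤ 1# - e
    choose (inj₁ ε≤1) = ε * H , *-pos 0<ε 0<H , half< 0<ε ,
      ≤⇒0≤- (≤-trans (proj₁ (half< 0<ε)) ε≤1)
    choose (inj₂ 1≤ε) = 1# * H , *-pos 0<1 0<H , <-≤-trans (half< 0<1) 1≤ε ,
      ≤⇒0≤- (proj₁ (half< 0<1))

  -- A feasible point of value at least L and the upper bound L + e give, by completeness, an
  -- optimal value squeezed between L and L + e.
  hasLimit : ∀ a L → (∀ n → 2 ℕ.≤ n → Attainable n a L) →
    (∀ ε → 0# < ε → 0# ≤ 1# - ε →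
      ∃[ N ] ∀ n → N ℕ.≤ n → 2 ℕ.≤ n → ∀ x → Feasible R n x → objective R n a x ≤ L + ε) →
    HasLimit R (λ n → IsOptimalValue R n a) L
  hasLimit a L attained bounded ε 0<ε =
    let e , 0<e , e<ε , e≤1 = small 0<ε
        N , upper = bounded e 0<e e≤1
    -- Both bounds are stated for n ≥ 2, where the constraint i = 2 is present.
    in N ℕ.⊔ 2 , λ n N⊔2≤n →
      let 2≤n = ℕ.m⊔n≤o⇒n≤o N 2 N⊔2≤n
      in optimum n e (attained n 2≤n) e<ε (upper n (ℕ.m⊔n≤o⇒m≤o N 2 N⊔2≤n) 2≤n)
    where
    optimum : ∀ n e → Attainable n a L → e < ε → (∀ x → Feasible R n x → objective R n a x ≤ L + e) →
              ∃[ v ] IsOptimalValue R n a v × ∣ v - L ∣ < ε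
    optimum n e (x₀ , feas₀ , L≤) e<ε upper =
      let v , isSup = complete Value (objective R n a x₀ , x₀ , feas₀ , refl) (L + e , y≤L+e)
          L≤v   = ≤-trans L≤ (proj₁ isSup (x₀ , feas₀ , refl))
          v-L≤e = 0≤-⇒≤ (0≤-resp (solve 3 (λ v L e → (L :+ e) :- v := e :- (v :- L)) refl v L e)
                    (≤⇒0≤- (IsSup⇒least R isSup y≤L+e)))
      in v , isSup , ∣∣<-nonneg (≤⇒0≤- L≤v) (≤-<-trans v-L≤e e<ε)
      where
      Value : Carrier → Set (c ⊔ ℓ₁ ⊔ ℓ₂)
      Value y = ∃[ x ] Feasible R n x × y ≈ objective R n a x
      y≤L+e : UpperBound Value (L + e)
      y≤L+e (x , feas , y≈) = ≤-resp (sym y≈) refl (upper x feas)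

-- Case distinction at a = 1/4

theorem2 : ∀ {c ℓ₁ ℓ₂} (R : CompleteOrderedField c ℓ₁ ℓ₂) →
    let open CompleteOrderedField R in
    ∀ a → (0<a : 0# < a) → a ≤ 1# / fromℕ 2 →
    HasLimit R (λ n → IsOptimalValue R n a) (θ R a 0<a)
theorem2 R a 0<a a≤1/2 = if-does (HasLimit R (λ n → IsOptimalValue R n a)) (a <? 1# / fromℕ 4) small-a large-a
  where
  open OrderedField R
  open LinearProgram R
  s : Carrier
  s = √ R a (proj₁ 0<a)
  0≤s : 0# ≤ s
  0≤s = proj₁ (proj₂ (sqrt R a (proj₁ 0<a)))
  s²≈a : s * s ≈ a
  s²≈a = proj₂ (proj₂ (sqrt R a (proj₁ 0<a)))

  small-a : a < 1# / fromℕ 4 → HasLimit R (λ n → IsOptimalValue R n a) ((1# - s) ^ 2 / a)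
  small-a a<1/4 = hasLimit a _ attained bounded
    where
    -- From (1 + 2 s)(1 - 2 s) = 1 - 4 a ≥ 0, cancelling the positive factor 1 + 2 s.
    2s≤1 : 0# ≤ 1# - (s + s)
    2s≤1 = *-cancel-nonneg (+-pos 0<1 (+-nonneg 0≤s 0≤s)) (0≤-resp
      (≈-by (fromℕ 4) s²≈a (solve 2 (λ s a → let four = :1 :+ (:1 :+ (:1 :+ (:1 :+ :0))) in
        :1 :- four :* a := (:1 :+ (s :+ s)) :* (:1 :- (s :+ s)) :+ four :* (s :* s :- a)) refl s a))
      (≤-reciprocal (fromℕ-pos 3) (proj₁ a<1/4)))
    open SmallA a s 0<a 0≤s s²≈a 2s≤1

  large-a : ¬ (a < 1# / fromℕ 4) → HasLimit R (λ n → IsOptimalValue R n a) (1# / (fromℕ 2 * a) - 1#)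
  -- The upper bound θ(a) holds for every n ≥ 2, so the threshold is 0 and ε only weakens it.
  large-a a≮1/4 = hasLimit a _ attained (λ ε 0<ε _ → 0 , λ n _ 2≤n x feas → ≤-trans (bounded n 2≤n x feas)
    (≤-resp (+-identityʳ _) refl (+-monoʳ-≤ _ (proj₁ 0<ε))))
    where
    1/4≤a : 1# / fromℕ 4 ≤ a
    1/4≤a with 1# / fromℕ 4 ≤? a
    ... | yes 1/4≤a = 1/4≤a
    ... | no  1/4≰a = contradiction (≰⇒> 1/4≰a) a≮1/4
    open LargeA a 0<a 1/4≤a a≤1/2
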